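{- Let $W$ be a string C-group, $\mathcal{P}(W)$ the regular abstract polytope with automorphism group $W$, and $N\le W$ a subgroup such that $\mathcal{P}(W)/N$ is a polytope on which $W$ acts via the flag action. Let $\mathrm{Core}(W,N)=\bigcap_{w\in W}N^{w}$. Suppose that $\mathcal{P}(W/\mathrm{Core}(W,N))$ is a well-defined regular polytope. Let $\mathcal{R}$ be any other regular cover of $\mathcal{P}(W)/N$ whose automorphism group acts on $\mathcal{P}(W)/N$ via the flag action, and on which $W$ acts likewise (so that $\mathcal{R}=\mathcal{P}(W)/K=\mathcal{P}(W/K)$ for a normal subgroup $K$ of $W$). Then $\mathcal{R}$ also covers $\mathcal{P}(W/\mathrm{Core}(W,N))$.
   Context: An abstract polytope is a graded poset with least and greatest faces, all flags (maximal chains) of the same length, strongly connected, and satisfying the diamond condition. A string C-group is a group generated by distinct involutions $s_0,\dots,s_{n-1}$ with $(s_is_j)^2=1$ for $|i-j|>1$ and satisfying the intersection property $\langle s_i:i\in I\rangle\cap\langle s_j:j\in J\rangle=\langle s_i:i\in I\cap J\rangle$; regular polytopes correspond bijectively to string C-groups, $\mathcal{P}(W)$ denoting the regular polytope with automorphism group $W$. For a polytope $\mathcal{Q}$, the flag action of $W$ sends a flag $\Phi$ under $s_i$ to the unique flag $\Phi^{s_i}$ differing from $\Phi$ only in its face of rank $i$, when this extends to a well-defined action of $W$ on the flags. For $N\le W$, $\mathcal{P}(W)/N$ denotes the quotient of $\mathcal{P}(W)$ by $N$; a polytope on which $W$ acts by the flag action is isomorphic to $\mathcal{P}(W)/N$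 where $N$ is the stabilizer of a base flag. $N^w=w^{ -1}Nw$.
   Formalization: N is additionally assumed to be the full stabilizer of the base flag of P(W)/N under the flag action; without this the claim fails, e.g. for W=[6,2,6] and N generated by (s0s1)^2(s2s3)^2, with R={2,2,2}. -}

module Defs where

open import Level using (Level; 0ℓ; _⊔_) renaming (suc to lsuc)
open import Algebra.Bundles using (Group)
import Algebra.Properties.Group as GroupProperties
open import Data.Fin.Base as Fin using (Fin; toℕ; inject₁)
import Data.Fin.Properties as Fin
open import Data.List.Base using (List)
open import Data.List.Relation.Unary.All using (All)
open import Data.List.Relation.Unary.AllPairs using (AllPairs)
open import Data.Nat.Base as ℕ using (ℕ; ∣_-_∣)
import Data.Nat.Properties as ℕ
open import Data.Product.Base using (∃; _×_; _,_; proj₁; proj₂)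
open import Data.Sum.Base using (_⊎_; inj₁; inj₂)
open import Function.Base using (_∘_; id)
open import Function.Definitions using (StrictlySurjective)
open import Relation.Binary.Bundles using (Poset)
open import Relation.Binary.Core using (Rel)
open import Relation.Binary.Construct.Closure.ReflexiveTransitive using (Star)
import Relation.Binary.Construct.NonStrictToStrict as ToStrict
open import Relation.Binary.Definitions using (Minimum; Maximum; tri<; tri≈; tri>)
open import Relation.Binary.Morphism.Bundles using (PosetHomomorphism)
import Relation.Binary.Morphism.Construct.Composition as Compose
import Relation.Binary.Morphism.Construct.Identity as Identity
open import Relation.Binary.PropositionalEquality as ≡ using (_≡_; _≢_)
import Relation.Binary.Reasoning.Setoid as SetoidReasoning
open import Relation.Nullary.Negation using (¬_; contradiction)
open import Relation.Unary using (Pred; _∈_; _⊆_; _∩_; _≐_; ⋂; U)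

-- A polytope of rank n has faces of ranks -1, …, n.  The face rank r is
-- stored as r + 1, so that the improper faces have index 0 and n + 1.

Rank : ℕ → Set
Rank n = Fin (2 ℕ.+ n)

proper : ∀ {n} → Fin n → Rank n
proper i = inject₁ (Fin.suc i)

-- `rank-injective` together with `rank-mono` says that the rank function
-- is strictly monotone.

record RankedPoset (n : ℕ) (a ℓ₁ ℓ₂ : Level) : Set (lsuc (a ⊔ ℓ₁ ⊔ ℓ₂)) where
  field
    poset : Poset a ℓ₁ ℓ₂
  open Poset poset public renaming (Carrier to Face)
  field
    rank           : Face → Rank n
    rank-cong      : ∀ {F G} → F ≈ G → rank F ≡ rank G
    rank-mono      : ∀ {F G} → F ≤ G → rank F Fin.≤ rank G
    rank-injective : ∀ {F G} → F ≤ G → rank F ≡ rank G → F ≈ G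

  open ToStrict _≈_ _≤_ public using (_<_)

  Incident : Rel Face ℓ₂
  Incident F G = F ≤ G ⊎ G ≤ F

  Chain : List Face → Set (a ⊔ ℓ₂)
  Chain = AllPairs Incident

  -- A chain with one face of each rank.  When every chain extends to one
  -- of these (as in `IsPolytope`), they are exactly the maximal chains.
  record Flag : Set (a ⊔ ℓ₂) where
    field
      face      : Rank n → Face
      face-rank : ∀ i → rank (face i) ≡ i
      face-mono : ∀ {i j} → i Fin.≤ j → face i ≤ face j
  open Flag public

  infix 4 _≋_ _∈ᶠ_

  _≋_ : Rel Flag ℓ₁
  Φ ≋ Ψ = ∀ i → face Φ i ≈ face Ψ i

  _∈ᶠ_ : Face → Flag → Set ℓ₁
  F ∈ᶠ Φ = ∃ λ i → F ≈ face Φ i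

  Adjacent : Fin n → Rel Flag ℓ₁
  Adjacent i Φ Ψ = (∀ j → j ≢ proper i → face Φ j ≈ face Ψ j)
                 × ¬ (face Φ (proper i) ≈ face Ψ (proper i))

  -- The proper faces of the section G/F.
  Between : Face → Face → Pred Face (ℓ₁ ⊔ ℓ₂)
  Between F G H = F < H × H < G

  IncidentBetween : ∀ F G → Rel (∃ (Between F G)) ℓ₂
  IncidentBetween F G (H , _) (K , _) = Incident H K

record IsPolytope {n a ℓ₁ ℓ₂} (P : RankedPoset n a ℓ₁ ℓ₂) :
                  Set (a ⊔ ℓ₁ ⊔ ℓ₂) where
  open RankedPoset P
  field
    least    : ∃ (Minimum _≤_)
    greatest : ∃ (Maximum _≤_)
    flags    : ∀ Fs → Chain Fs → ∃ λ Φ → All (_∈ᶠ Φ) Fs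

    -- Every section of rank at least 2 is connected; the section G/F has
    -- rank (rank G - rank F - 1).
    stronglyConnected : ∀ {F G} → F ≤ G →
      3 ℕ.+ toℕ (rank F) ℕ.≤ toℕ (rank G) →
      ∀ H K → Star (IncidentBetween F G) H K

    diamond : ∀ {F G} → F ≤ G → toℕ (rank G) ≡ 2 ℕ.+ toℕ (rank F) →
      ∃ λ H₁ → ∃ λ H₂ → ¬ (H₁ ≈ H₂) × Between F G H₁ × Between F G H₂ ×
      (∀ H → Between F G H → H ≈ H₁ ⊎ H ≈ H₂)

module _ {n a ℓ₁ ℓ₂} (P : RankedPoset n a ℓ₁ ℓ₂) where
  open RankedPoset P
  private
    open module Hom = PosetHomomorphism using (⟦_⟧)

  -- In a polytope these automatically preserve rank.
  record Automorphism : Set (a ⊔ ℓ₁ ⊔ ℓ₂) where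
    field
      to       : PosetHomomorphism poset poset
      from     : PosetHomomorphism poset poset
      inverseˡ : ∀ F → ⟦ to ⟧ (⟦ from ⟧ F) ≈ F
      inverseʳ : ∀ F → ⟦ from ⟧ (⟦ to ⟧ F) ≈ F

    apply : Face → Face
    apply = ⟦ to ⟧
  open Automorphism

  -- The product γ ∙ δ is the composite "first δ, then γ".
  Aut : Group (a ⊔ ℓ₁ ⊔ ℓ₂) (a ⊔ ℓ₁)
  Aut = record
    { Carrier = Automorphism
    ; _≈_ = λ γ δ → ∀ F → apply γ F ≈ apply δ F
    ; _∙_ = λ γ δ → record
      { to       = Compose.posetHomomorphism (to δ) (to γ)
      ; from     = Compose.posetHomomorphism (from γ) (from δ)
      ; inverseˡ = λ F → Eq.trans (Hom.cong (to γ) (inverseˡ δ _)) (inverseˡ γ F)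
      ; inverseʳ = λ F → Eq.trans (Hom.cong (from δ) (inverseʳ γ _)) (inverseʳ δ F)
      }
    ; ε = record
      { to       = Identity.posetHomomorphism poset
      ; from     = Identity.posetHomomorphism poset
      ; inverseˡ = λ _ → Eq.refl
      ; inverseʳ = λ _ → Eq.refl
      }
    ; _⁻¹ = λ γ → record
      { to = from γ ; from = to γ ; inverseˡ = inverseʳ γ ; inverseʳ = inverseˡ γ }
    ; isGroup = record
      { isMonoid = record
        { isSemigroup = record
          { isMagma = record
            { isEquivalence = record
              { refl  = λ _ → Eq.refl
              ; sym   = λ p F → Eq.sym (p F)
              ; trans = λ p q F → Eq.trans (p F) (q F)
              }
            ; ∙-cong = λ {γ} p q F → Eq.trans (Hom.cong (to γ) (q F)) (p _)
            }
          ; assoc = λ _ _ _ _ → Eq.refl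
          }
        ; identity = (λ _ _ → Eq.refl) , (λ _ _ → Eq.refl)
        }
      ; inverse = inverseʳ , inverseˡ
      ; ⁻¹-cong = λ {γ} {δ} p F → Eq.trans
          (Hom.cong (from γ) (Eq.trans (Eq.sym (inverseˡ δ F)) (Eq.sym (p _))))
          (inverseʳ γ _)
      }
    }

  record IsRegularPolytope : Set (a ⊔ ℓ₁ ⊔ ℓ₂) where
    field
      isPolytope     : IsPolytope P
      flagTransitive : ∀ Φ Ψ → ∃ λ γ → ∀ i → apply γ (face Φ i) ≈ face Ψ i

  -- ρᵢ is the automorphism taking the base flag Φ to the flag Φ^{sᵢ}.
  Distinguished : Flag → (Fin n → Automorphism) → Set ℓ₁
  Distinguished Φ ρ = ∀ i →
    (∀ j → j ≢ proper i → apply (ρ i) (face Φ j) ≈ face Φ j) ×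
    ¬ (apply (ρ i) (face Φ (proper i)) ≈ face Φ (proper i))

record Covering {n a ℓ₁ ℓ₂ b ℓ₃ ℓ₄}
                (P : RankedPoset n a ℓ₁ ℓ₂) (Q : RankedPoset n b ℓ₃ ℓ₄) :
                Set (a ⊔ ℓ₁ ⊔ ℓ₂ ⊔ b ⊔ ℓ₃ ⊔ ℓ₄) where
  private
    module P = RankedPoset P
    module Q = RankedPoset Q
  field
    hom : PosetHomomorphism P.poset Q.poset
  open PosetHomomorphism hom public
  field
    rank-preserving : ∀ F → Q.rank ⟦ F ⟧ ≡ P.rank F

  mapFlag : P.Flag → Q.Flag
  mapFlag Φ = record
    { face      = λ i → ⟦ P.face Φ i ⟧
    ; face-rank = λ i → ≡.trans (rank-preserving _) (P.face-rank Φ i)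
    ; face-mono = λ i≤j → mono (P.face-mono Φ i≤j)
    }

  field
    adjacency-preserving : ∀ {i Φ Ψ} → P.Adjacent i Φ Ψ →
                           Q.Adjacent i (mapFlag Φ) (mapFlag Ψ)
    surjective           : StrictlySurjective Q._≈_ ⟦_⟧

_Covers_ : ∀ {n a ℓ₁ ℓ₂ b ℓ₃ ℓ₄} →
           RankedPoset n a ℓ₁ ℓ₂ → RankedPoset n b ℓ₃ ℓ₄ →
           Set (a ⊔ ℓ₁ ⊔ ℓ₂ ⊔ b ⊔ ℓ₃ ⊔ ℓ₄)
_Covers_ = Covering

-- A right action of G on the flags of P for which each sᵢ sends Φ to an
-- i-adjacent flag.  In a polytope that flag is unique by the diamond
-- condition, so the action is determined by this.

record FlagAction {n a ℓ₁ ℓ₂ c ℓ} (G : Group c ℓ) (s : Fin n → Group.Carrier G)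
                  (P : RankedPoset n a ℓ₁ ℓ₂) : Set (a ⊔ ℓ₁ ⊔ ℓ₂ ⊔ c ⊔ ℓ) where
  open RankedPoset P using (Flag; _≋_; Adjacent)
  open Group G
  infixl 7 _·_
  field
    _·_    : Flag → Carrier → Flag
    ·-cong : ∀ {Φ Ψ g h} → Φ ≋ Ψ → g ≈ h → Φ · g ≋ Ψ · h
    ·-ε    : ∀ Φ → Φ · ε ≋ Φ
    ·-∙    : ∀ Φ g h → Φ · (g ∙ h) ≋ Φ · g · h
    ·-gen  : ∀ Φ i → Adjacent i Φ (Φ · s i)

module _ {c ℓ} (G : Group c ℓ) where
  open Group G
  open GroupProperties G
  open SetoidReasoning setoid

  record Subgroup (p : Level) : Set (c ⊔ ℓ ⊔ lsuc p) where
    field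
      Member    : Pred Carrier p
      resp      : ∀ {x y} → x ≈ y → x ∈ Member → y ∈ Member
      ε-closed  : ε ∈ Member
      ∙-closed  : ∀ {x y} → x ∈ Member → y ∈ Member → x ∙ y ∈ Member
      ⁻¹-closed : ∀ {x} → x ∈ Member → x ⁻¹ ∈ Member
  open Subgroup

  Conjugate : ∀ {p} → Subgroup p → Carrier → Pred Carrier (c ⊔ ℓ ⊔ p)
  Conjugate N w x = ∃ λ m → m ∈ Member N × x ≈ w ⁻¹ ∙ m ∙ w

  Normal : ∀ {p} → Subgroup p → Set (c ⊔ ℓ ⊔ p)
  Normal N = ∀ w → Conjugate N w ⊆ Member N

  private
    cancel-mid : ∀ x y z → (x ∙ y) ∙ (y ⁻¹ ∙ z) ≈ x ∙ z
    cancel-mid x y z = trans (assoc x y _) (∙-congˡ (\\-leftDividesˡ y z))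

    cancel-mid⁻¹ : ∀ x y z → (x ∙ y ⁻¹) ∙ (y ∙ z) ≈ x ∙ z
    cancel-mid⁻¹ x y z = trans (assoc x _ _) (∙-congˡ (\\-leftDividesʳ y z))

    conj-∙ : ∀ w x y → w ⁻¹ ∙ (x ∙ y) ∙ w ≈ (w ⁻¹ ∙ x ∙ w) ∙ (w ⁻¹ ∙ y ∙ w)
    conj-∙ w x y = begin
      w ⁻¹ ∙ (x ∙ y) ∙ w                  ≈⟨ ∙-congʳ (assoc _ x y) ⟨
      w ⁻¹ ∙ x ∙ y ∙ w                    ≈⟨ assoc _ y w ⟩
      w ⁻¹ ∙ x ∙ (y ∙ w)                  ≈⟨ cancel-mid _ w _ ⟨
      (w ⁻¹ ∙ x ∙ w) ∙ (w ⁻¹ ∙ (y ∙ w))   ≈⟨ ∙-congˡ (assoc _ y w) ⟨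
      (w ⁻¹ ∙ x ∙ w) ∙ (w ⁻¹ ∙ y ∙ w)     ∎

    conj-ε : ∀ w → w ⁻¹ ∙ ε ∙ w ≈ ε
    conj-ε w = trans (∙-congʳ (identityʳ _)) (inverseˡ w)

    conj-⁻¹ : ∀ w x → w ⁻¹ ∙ x ⁻¹ ∙ w ≈ (w ⁻¹ ∙ x ∙ w) ⁻¹
    conj-⁻¹ w x = inverseˡ-unique _ _ (begin
      (w ⁻¹ ∙ x ⁻¹ ∙ w) ∙ (w ⁻¹ ∙ x ∙ w)  ≈⟨ conj-∙ w (x ⁻¹) x ⟨
      w ⁻¹ ∙ (x ⁻¹ ∙ x) ∙ w               ≈⟨ ∙-congʳ (∙-congˡ (inverseˡ x)) ⟩
      w ⁻¹ ∙ ε ∙ w                        ≈⟨ conj-ε w ⟩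
      ε                                   ∎)

    conj-conj : ∀ v w x → w ⁻¹ ∙ (v ⁻¹ ∙ x ∙ v) ∙ w ≈ (v ∙ w) ⁻¹ ∙ x ∙ (v ∙ w)
    conj-conj v w x = begin
      w ⁻¹ ∙ (v ⁻¹ ∙ x ∙ v) ∙ w    ≈⟨ ∙-congʳ (assoc _ _ v) ⟨
      w ⁻¹ ∙ (v ⁻¹ ∙ x) ∙ v ∙ w    ≈⟨ assoc _ v w ⟩
      w ⁻¹ ∙ (v ⁻¹ ∙ x) ∙ (v ∙ w)  ≈⟨ ∙-congʳ (assoc _ _ x) ⟨
      w ⁻¹ ∙ v ⁻¹ ∙ x ∙ (v ∙ w)    ≈⟨ ∙-congʳ (∙-congʳ (⁻¹-anti-homo-∙ v w)) ⟨
      (v ∙ w) ⁻¹ ∙ x ∙ (v ∙ w)     ∎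

  Core : ∀ {p} → Subgroup p → Subgroup (c ⊔ ℓ ⊔ p)
  Core N = record
    { Member    = ⋂ Carrier (Conjugate N)
    ; resp      = λ x≈y x∈ w → let m , m∈ , eq = x∈ w in
                    m , m∈ , trans (sym x≈y) eq
    ; ε-closed  = λ w → ε , ε-closed N , sym (conj-ε w)
    ; ∙-closed  = λ x∈ y∈ w →
                    let m , m∈ , eq = x∈ w ; k , k∈ , eq′ = y∈ w in
                    m ∙ k , ∙-closed N m∈ k∈ ,
                    trans (∙-cong eq eq′) (sym (conj-∙ w m k))
    ; ⁻¹-closed = λ x∈ w → let m , m∈ , eq = x∈ w in
                    m ⁻¹ , ⁻¹-closed N m∈ ,
                    trans (⁻¹-cong eq) (sym (conj-⁻¹ w m))
    }

  Core-normal : ∀ {p} (N : Subgroup p) → Normal (Core N)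
  Core-normal N g {x} (k , k∈ , eq) w =
    let m , m∈ , eq′ = k∈ (w ∙ g ⁻¹) in m , m∈ , (begin
      x                                              ≈⟨ eq ⟩
      g ⁻¹ ∙ k ∙ g                                   ≈⟨ ∙-congʳ (∙-congˡ eq′) ⟩
      g ⁻¹ ∙ ((w ∙ g ⁻¹) ⁻¹ ∙ m ∙ (w ∙ g ⁻¹)) ∙ g    ≈⟨ conj-conj _ g m ⟩
      (w ∙ g ⁻¹ ∙ g) ⁻¹ ∙ m ∙ (w ∙ g ⁻¹ ∙ g)         ≈⟨ ∙-cong (∙-congʳ (⁻¹-cong (//-rightDividesˡ g w))) (//-rightDividesˡ g w) ⟩
      w ⁻¹ ∙ m ∙ w                                   ∎)

  QuotientGroup : ∀ {p} (K : Subgroup p) → Normal K → Group c p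
  QuotientGroup K normal = record
    { Carrier = Carrier
    ; _≈_     = λ x y → x ⁻¹ ∙ y ∈ Member K
    ; _∙_     = _∙_
    ; ε       = ε
    ; _⁻¹     = _⁻¹
    ; isGroup = record
      { isMonoid = record
        { isSemigroup = record
          { isMagma = record
            { isEquivalence = record
              { refl  = ≈⇒ refl
              ; sym   = λ {x} {y} p → resp K (⁻¹-anti-homo-\\ x y) (⁻¹-closed K p)
              ; trans = λ {x} {y} {z} p q →
                          resp K (trans (assoc _ _ _) (∙-congˡ (\\-leftDividesˡ y z)))
                                 (∙-closed K p q)
              }
            ; ∙-cong = λ {x} {y} {u} {v} p q → resp K (begin
                (u ⁻¹ ∙ (x ⁻¹ ∙ y) ∙ u) ∙ (u ⁻¹ ∙ v)  ≈⟨ cancel-mid _ u v ⟩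
                u ⁻¹ ∙ (x ⁻¹ ∙ y) ∙ v                 ≈⟨ ∙-congʳ (assoc _ _ y) ⟨
                u ⁻¹ ∙ x ⁻¹ ∙ y ∙ v                   ≈⟨ assoc _ y v ⟩
                u ⁻¹ ∙ x ⁻¹ ∙ (y ∙ v)                 ≈⟨ ∙-congʳ (⁻¹-anti-homo-∙ x u) ⟨
                (x ∙ u) ⁻¹ ∙ (y ∙ v)                  ∎)
                (∙-closed K (normal u (_ , p , refl)) q)
            }
          ; assoc = λ x y z → ≈⇒ (assoc x y z)
          }
        ; identity = (λ x → ≈⇒ (identityˡ x)) , (λ x → ≈⇒ (identityʳ x))
        }
      ; inverse = (λ x → ≈⇒ (inverseˡ x)) , (λ x → ≈⇒ (inverseʳ x))
      ; ⁻¹-cong = λ {x} {y} p → resp K (begin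
          (y ⁻¹) ⁻¹ ∙ (x ⁻¹ ∙ y) ⁻¹ ∙ y ⁻¹  ≈⟨ ∙-cong (∙-cong (⁻¹-involutive y) (⁻¹-anti-homo-\\ x y)) refl ⟩
          y ∙ (y ⁻¹ ∙ x) ∙ y ⁻¹             ≈⟨ ∙-congʳ (\\-leftDividesˡ y x) ⟩
          x ∙ y ⁻¹                          ≈⟨ ∙-congʳ (⁻¹-involutive x) ⟨
          (x ⁻¹) ⁻¹ ∙ y ⁻¹                  ∎)
          (normal (y ⁻¹) (_ , ⁻¹-closed K p , refl))
      }
    }
    where
    ≈⇒ : ∀ {x y} → x ≈ y → x ⁻¹ ∙ y ∈ Member K
    ≈⇒ {x} x≈y = resp K (trans (sym (inverseˡ x)) (∙-congˡ x≈y)) (ε-closed K)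

module _ {c ℓ} (G : Group c ℓ) where
  open Group G

  data ⟨_⟩ {n} (s : Fin n → Carrier) (J : Pred (Fin n) 0ℓ) :
           Pred Carrier (c ⊔ ℓ) where
    gen  : ∀ {j} → j ∈ J → ⟨ s ⟩ J (s j)
    unit : ⟨ s ⟩ J ε
    mult : ∀ {x y} → ⟨ s ⟩ J x → ⟨ s ⟩ J y → ⟨ s ⟩ J (x ∙ y)
    inv  : ∀ {x} → ⟨ s ⟩ J x → ⟨ s ⟩ J (x ⁻¹)
    resp : ∀ {x y} → x ≈ y → ⟨ s ⟩ J x → ⟨ s ⟩ J y

  -- A membership proof mentions finitely many generators only, so it makes
  -- no difference whether the index sets I and J are taken to be decidable.
  record IsStringCGroup {n} (s : Fin n → Carrier) : Set (c ⊔ ℓ ⊔ lsuc 0ℓ) where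
    field
      generates    : ∀ g → g ∈ ⟨ s ⟩ U
      involutive   : ∀ i → s i ∙ s i ≈ ε
      nontrivial   : ∀ i → ¬ (s i ≈ ε)
      distinct     : ∀ {i j} → i ≢ j → ¬ (s i ≈ s j)
      string       : ∀ i j → 1 ℕ.< ∣ toℕ i - toℕ j ∣ →
                     (s i ∙ s j) ∙ (s i ∙ s j) ≈ ε
      intersection : ∀ (I J : Pred (Fin n) 0ℓ) →
                     ⟨ s ⟩ I ∩ ⟨ s ⟩ J ≐ ⟨ s ⟩ (I ∩ J)

record StringCGroup (n : ℕ) (c ℓ : Level) : Set (lsuc (c ⊔ ℓ)) where
  constructor stringCGroup
  field
    group          : Group c ℓ
    gens           : Fin n → Group.Carrier group
    isStringCGroup : IsStringCGroup group gens

module _ {n c ℓ} (W : StringCGroup n c ℓ) where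
  open StringCGroup W
  open Group group hiding (_≈_) renaming (Carrier to C)
  open Group group using (_≈_)
  open GroupProperties group
  open IsStringCGroup isStringCGroup
  open SetoidReasoning setoid

  Off Below Above : Rank n → Pred (Fin n) 0ℓ
  Off   i k = proper k ≢ i
  Below i k = proper k Fin.< i
  Above i k = i Fin.< proper k

  private
    H : Pred (Fin n) 0ℓ → Pred C (c ⊔ ℓ)
    H = ⟨_⟩ group gens

    H-mono : ∀ {I J} → I ⊆ J → H I ⊆ H J
    H-mono I⊆J (gen j∈I)   = gen (I⊆J j∈I)
    H-mono I⊆J unit        = unit
    H-mono I⊆J (mult p q)  = mult (H-mono I⊆J p) (H-mono I⊆J q)
    H-mono I⊆J (inv p)     = inv (H-mono I⊆J p)
    H-mono I⊆J (resp eq p) = resp eq (H-mono I⊆J p)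

    s⁻¹ : ∀ i → gens i ⁻¹ ≈ gens i
    s⁻¹ i = sym (inverseˡ-unique _ _ (involutive i))

    far-commute : ∀ i j → 1 ℕ.< ∣ toℕ i - toℕ j ∣ →
                  gens i ∙ gens j ≈ gens j ∙ gens i
    far-commute i j far = begin
      gens i ∙ gens j          ≈⟨ inverseˡ-unique _ _ (string i j far) ⟩
      (gens i ∙ gens j) ⁻¹     ≈⟨ ⁻¹-anti-homo-∙ _ _ ⟩
      gens j ⁻¹ ∙ gens i ⁻¹    ≈⟨ ∙-cong (s⁻¹ j) (s⁻¹ i) ⟩
      gens j ∙ gens i          ∎

    centralises : ∀ {J} x → (∀ {j} → j ∈ J → x ∙ gens j ≈ gens j ∙ x) →
                  ∀ {y} → y ∈ H J → x ∙ y ≈ y ∙ x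
    centralises x com (gen j∈J) = com j∈J
    centralises x com unit = trans (identityʳ x) (sym (identityˡ x))
    centralises x com (mult {y} {z} p q) = begin
      x ∙ (y ∙ z)  ≈⟨ assoc x y z ⟨
      x ∙ y ∙ z    ≈⟨ ∙-congʳ (centralises x com p) ⟩
      y ∙ x ∙ z    ≈⟨ assoc y x z ⟩
      y ∙ (x ∙ z)  ≈⟨ ∙-congˡ (centralises x com q) ⟩
      y ∙ (z ∙ x)  ≈⟨ assoc y z x ⟨
      y ∙ z ∙ x    ∎
    centralises x com (inv {y} p) = begin
      x ∙ y ⁻¹                  ≈⟨ \\-leftDividesʳ y _ ⟨
      y ⁻¹ ∙ (y ∙ (x ∙ y ⁻¹))   ≈⟨ ∙-congˡ (assoc y x _) ⟨
      y ⁻¹ ∙ (y ∙ x ∙ y ⁻¹)     ≈⟨ ∙-congˡ (∙-congʳ (centralises x com p)) ⟨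
      y ⁻¹ ∙ (x ∙ y ∙ y ⁻¹)     ≈⟨ ∙-congˡ (//-rightDividesʳ y x) ⟩
      y ⁻¹ ∙ x                  ∎
    centralises x com (resp eq p) =
      trans (∙-congˡ (sym eq)) (trans (centralises x com p) (∙-congʳ eq))

    below-above-far : ∀ {i j k} → j ∈ Below i → k ∈ Above i →
                      1 ℕ.< ∣ toℕ j - toℕ k ∣
    below-above-far {i} {j} {k} j<i i<k = ≡.subst (1 ℕ.<_)
      (≡.sym (ℕ.m≤n⇒∣m-n∣≡n∸m (ℕ.≤-trans (ℕ.m≤n+m _ 2) 2+j≤k)))
      (≡.subst (ℕ._≤ toℕ k ℕ.∸ toℕ j) (ℕ.m+n∸n≡m 2 (toℕ j))
        (ℕ.∸-monoˡ-≤ (toℕ j) 2+j≤k))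
      where
      2+j≤k : 2 ℕ.+ toℕ j ℕ.≤ toℕ k
      2+j≤k = ℕ.≤-pred (≡.subst₂ (λ a b → 2 ℕ.+ a ℕ.≤ b)
        (Fin.toℕ-inject₁ (Fin.suc j)) (Fin.toℕ-inject₁ (Fin.suc k))
        (ℕ.≤-trans (ℕ.s≤s j<i) i<k))

    commute : ∀ {i x y} → x ∈ H (Below i) → y ∈ H (Above i) → x ∙ y ≈ y ∙ x
    commute {i} {x} {y} p q = centralises x (λ {k} k∈ →
      sym (centralises (gens k) (λ {j} j∈ →
        sym (far-commute j k (below-above-far {i} j∈ k∈))) p)) q

    interchange : ∀ {i x y u v} → x ∈ H (Below i) → y ∈ H (Above i) →
                  (u ∙ y) ∙ (x ∙ v) ≈ (u ∙ x) ∙ (y ∙ v)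
    interchange {x = x} {y} {u} {v} p q = begin
      (u ∙ y) ∙ (x ∙ v)  ≈⟨ assoc u y _ ⟩
      u ∙ (y ∙ (x ∙ v))  ≈⟨ ∙-congˡ (assoc y x v) ⟨
      u ∙ (y ∙ x ∙ v)    ≈⟨ ∙-congˡ (∙-congʳ (commute p q)) ⟨
      u ∙ (x ∙ y ∙ v)    ≈⟨ ∙-congˡ (assoc x y v) ⟩
      u ∙ (x ∙ (y ∙ v))  ≈⟨ assoc u x _ ⟨
      (u ∙ x) ∙ (y ∙ v)  ∎

    split : ∀ {i g} → g ∈ H (Off i) →
            ∃ λ x → ∃ λ y → x ∈ H (Below i) × y ∈ H (Above i) × g ≈ x ∙ y
    split {i} (gen {k} k≢i) with Fin.<-cmp (proper k) i
    ... | tri< k<i _ _ = gens k , ε , gen k<i , unit , sym (identityʳ _)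
    ... | tri≈ _ k≡i _ = contradiction k≡i k≢i
    ... | tri> _ _ k>i = ε , gens k , unit , gen k>i , sym (identityˡ _)
    split unit = ε , ε , unit , unit , sym (identityˡ ε)
    split (mult p q) with split p | split q
    ... | x , y , x∈ , y∈ , eq | u , v , u∈ , v∈ , eq′ =
      x ∙ u , y ∙ v , mult x∈ u∈ , mult y∈ v∈ ,
      trans (∙-cong eq eq′) (interchange u∈ y∈)
    split (inv p) with split p
    ... | x , y , x∈ , y∈ , eq =
      x ⁻¹ , y ⁻¹ , inv x∈ , inv y∈ ,
      trans (⁻¹-cong eq) (trans (⁻¹-anti-homo-∙ x y)
        (sym (commute (inv x∈) (inv y∈))))
    split (resp eq p) with split p
    ... | x , y , x∈ , y∈ , eq′ = x , y , x∈ , y∈ , trans (sym eq) eq′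

    Below⊆Off : ∀ {i j} → i Fin.≤ j → Below i ⊆ Off j
    Below⊆Off i≤j k<i ≡.refl = ℕ.<⇒≱ k<i i≤j

    Above⊆Off : ∀ {i j} → i Fin.≤ j → Above j ⊆ Off i
    Above⊆Off i≤j j<k ≡.refl = ℕ.<⇒≱ j<k i≤j

  -- The pair (i , w) stands for the face w Wᵢ, where Wᵢ is generated by
  -- all the s_k other than the one of rank i.  For the improper ranks
  -- Wᵢ = W, giving a single face each.  With left cosets, W acts as the
  -- automorphism group by left multiplication, and the flag action is
  -- {w Wᵢ}ᵢ · s_j = {w s_j Wᵢ}ᵢ.
  CosetFace : Set c
  CosetFace = Rank n × C

  coset : CosetFace → Pred C (c ⊔ ℓ)
  coset (i , w) g = w ⁻¹ ∙ g ∈ ⟨ group ⟩ gens (Off i)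

  infix 4 _≃_ _⊑_

  _≃_ : Rel CosetFace (c ⊔ ℓ)
  F ≃ G = proj₁ F ≡ proj₁ G × coset F ≐ coset G

  _⊑_ : Rel CosetFace (c ⊔ ℓ)
  F ⊑ G = proj₁ F Fin.≤ proj₁ G × ∃ (coset F ∩ coset G)

  private
    coset-∙ : ∀ {F x h} → x ∈ coset F → h ∈ H (Off (proj₁ F)) → x ∙ h ∈ coset F
    coset-∙ p q = resp (assoc _ _ _) (mult p q)

    coset-meet : ∀ {i u v g} → g ∈ coset (i , u) → g ∈ coset (i , v) →
                 coset (i , u) ⊆ coset (i , v)
    coset-meet {i} {u} {v} {g} p q {x} r = resp (begin
      (v ⁻¹ ∙ g) ∙ ((u ⁻¹ ∙ g) ⁻¹ ∙ (u ⁻¹ ∙ x))  ≈⟨ ∙-congˡ (∙-congʳ (⁻¹-anti-homo-\\ u g)) ⟩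
      (v ⁻¹ ∙ g) ∙ ((g ⁻¹ ∙ u) ∙ (u ⁻¹ ∙ x))     ≈⟨ ∙-congˡ (assoc _ u _) ⟩
      (v ⁻¹ ∙ g) ∙ (g ⁻¹ ∙ (u ∙ (u ⁻¹ ∙ x)))     ≈⟨ ∙-congˡ (∙-congˡ (\\-leftDividesˡ u x)) ⟩
      (v ⁻¹ ∙ g) ∙ (g ⁻¹ ∙ x)                    ≈⟨ assoc _ g _ ⟩
      v ⁻¹ ∙ (g ∙ (g ⁻¹ ∙ x))                    ≈⟨ ∙-congˡ (\\-leftDividesˡ g x) ⟩
      v ⁻¹ ∙ x                                   ∎)
      (mult q (mult (inv p) r))

    coset-self : ∀ F → proj₂ F ∈ coset F
    coset-self (i , w) = resp (sym (inverseˡ w)) unit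

    ≃-refl : ∀ {F} → F ≃ F
    ≃-refl = ≡.refl , id , id

    ≃-sym : ∀ {F G} → F ≃ G → G ≃ F
    ≃-sym (e , p , q) = ≡.sym e , q , p

    ≃-trans : ∀ {F G K} → F ≃ G → G ≃ K → F ≃ K
    ≃-trans (e , p , q) (e′ , p′ , q′) = ≡.trans e e′ , p′ ∘ p , q ∘ q′

    ⊑-reflexive : ∀ {F G} → F ≃ G → F ⊑ G
    ⊑-reflexive {F} (e , p , _) =
      ℕ.≤-reflexive (≡.cong toℕ e) , proj₂ F , coset-self F , p (coset-self F)

    ⊑-injective : ∀ {F G} → F ⊑ G → proj₁ F ≡ proj₁ G → F ≃ G
    ⊑-injective (_ , g , p , q) ≡.refl = ≡.refl , coset-meet p q , coset-meet q p

    ⊑-antisym : ∀ {F G} → F ⊑ G → G ⊑ F → F ≃ G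
    ⊑-antisym F⊑G G⊑F =
      ⊑-injective F⊑G (Fin.≤-antisym (proj₁ F⊑G) (proj₁ G⊑F))

    ⊑-trans : ∀ {F G K} → F ⊑ G → G ⊑ K → F ⊑ K
    ⊑-trans {F} {j , v} {K} (i≤j , g , gF , gG) (j≤k , h , hG , hK)
      with split (mult (inv gG) hG)
    ... | x , y , x∈ , y∈ , eq =
      ℕ.≤-trans i≤j j≤k , g ∙ y , coset-∙ {F} gF (H-mono (Above⊆Off i≤j) y∈) ,
      resp (∙-congˡ (sym g∙y≈h∙x⁻¹))
        (coset-∙ {K} hK (inv (H-mono (Below⊆Off j≤k) x∈)))
      where
      g⁻¹h : g ⁻¹ ∙ h ≈ x ∙ y
      g⁻¹h = begin
        g ⁻¹ ∙ h                         ≈⟨ ∙-congˡ (\\-leftDividesˡ v h) ⟨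
        g ⁻¹ ∙ (v ∙ (v ⁻¹ ∙ h))          ≈⟨ assoc _ v _ ⟨
        (g ⁻¹ ∙ v) ∙ (v ⁻¹ ∙ h)          ≈⟨ ∙-congʳ (⁻¹-anti-homo-\\ v g) ⟨
        (v ⁻¹ ∙ g) ⁻¹ ∙ (v ⁻¹ ∙ h)       ≈⟨ eq ⟩
        x ∙ y                            ∎
      g∙y≈h∙x⁻¹ : g ∙ y ≈ h ∙ x ⁻¹
      g∙y≈h∙x⁻¹ = begin
        g ∙ y                       ≈⟨ ∙-congˡ (//-rightDividesʳ x y) ⟨
        g ∙ (y ∙ x ∙ x ⁻¹)          ≈⟨ ∙-congˡ (∙-congʳ (commute x∈ y∈)) ⟨
        g ∙ (x ∙ y ∙ x ⁻¹)          ≈⟨ ∙-congˡ (∙-congʳ g⁻¹h) ⟨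
        g ∙ (g ⁻¹ ∙ h ∙ x ⁻¹)       ≈⟨ ∙-congˡ (assoc _ h _) ⟩
        g ∙ (g ⁻¹ ∙ (h ∙ x ⁻¹))     ≈⟨ \\-leftDividesˡ g _ ⟩
        h ∙ x ⁻¹                    ∎

  𝒫 : RankedPoset n c (c ⊔ ℓ) (c ⊔ ℓ)
  𝒫 = record
    { poset = record
      { Carrier = CosetFace
      ; _≈_     = _≃_
      ; _≤_     = _⊑_
      ; isPartialOrder = record
        { isPreorder = record
          { isEquivalence = record
            { refl = λ {F} → ≃-refl {F}
            ; sym = λ {F} {G} → ≃-sym {F} {G}
            ; trans = λ {F} {G} {K} → ≃-trans {F} {G} {K} }
          ; reflexive = λ {F} {G} → ⊑-reflexive {F} {G}
          ; trans = λ {F} {G} {K} → ⊑-trans {F} {G} {K}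
          }
        ; antisym = λ {F} {G} → ⊑-antisym {F} {G}
        }
      }
    ; rank           = proj₁
    ; rank-cong      = proj₁
    ; rank-mono      = proj₁
    ; rank-injective = λ {F} {G} → ⊑-injective {F} {G}
    }

  infixr 8 _▷_

  _▷_ : C → CosetFace → CosetFace
  m ▷ (i , w) = i , m ∙ w

  private
    translate : ∀ m w g → (m ∙ w) ⁻¹ ∙ (m ∙ g) ≈ w ⁻¹ ∙ g
    translate m w g = begin
      (m ∙ w) ⁻¹ ∙ (m ∙ g)       ≈⟨ ∙-congʳ (⁻¹-anti-homo-∙ m w) ⟩
      w ⁻¹ ∙ m ⁻¹ ∙ (m ∙ g)      ≈⟨ assoc _ _ _ ⟩
      w ⁻¹ ∙ (m ⁻¹ ∙ (m ∙ g))    ≈⟨ ∙-congˡ (\\-leftDividesʳ m g) ⟩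
      w ⁻¹ ∙ g                   ∎

    ▷-coset : ∀ m F {g} → g ∈ coset F → m ∙ g ∈ coset (m ▷ F)
    ▷-coset m (i , w) = resp (sym (translate m w _))

    ▷-mono : ∀ m {F G} → F ⊑ G → m ▷ F ⊑ m ▷ G
    ▷-mono m {F} {G} (i≤j , g , p , q) =
      i≤j , m ∙ g , ▷-coset m F p , ▷-coset m G q

    ▷-cong : ∀ m {F G} → F ≃ G → m ▷ F ≃ m ▷ G
    ▷-cong m {F} {G} F≃G =
      ⊑-injective (▷-mono m {F} {G} (⊑-reflexive F≃G)) (proj₁ F≃G)

    rep-cong : ∀ {i u v} → u ≈ v → (i , u) ≃ (i , v)
    rep-cong u≈v =
      ≡.refl , resp (∙-congʳ (⁻¹-cong u≈v)) , resp (∙-congʳ (⁻¹-cong (sym u≈v)))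

  -- The faces of the quotient are the N-orbits of faces, and two orbits are
  -- incident when they have incident representatives.
  quotient : ∀ {p} → Subgroup group p → RankedPoset n c (c ⊔ ℓ ⊔ p) (c ⊔ ℓ ⊔ p)
  quotient {p} N = record
    { poset = record
      { Carrier = CosetFace
      ; _≈_     = _~_
      ; _≤_     = _≲_
      ; isPartialOrder = record
        { isPreorder = record
          { isEquivalence = record
            { refl = λ {F} → ~-refl {F}
            ; sym = λ {F} {G} → ~-sym {F} {G}
            ; trans = λ {F} {G} {K} → ~-trans {F} {G} {K}
            }
          ; reflexive = λ (m , m∈ , p) → m , m∈ , ⊑-reflexive p
          ; trans = λ {F} {G} {K} → ≲-trans {F} {G} {K}
          }
        ; antisym = λ (m , m∈ , p) (_ , _ , q) →
            m , m∈ , ⊑-injective p (Fin.≤-antisym (proj₁ p) (proj₁ q))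
        }
      }
    ; rank           = proj₁
    ; rank-cong      = λ (_ , _ , p) → proj₁ p
    ; rank-mono      = λ (_ , _ , p) → proj₁ p
    ; rank-injective = λ (m , m∈ , p) e → m , m∈ , ⊑-injective p e
    }
    where
    open Subgroup N using (Member; ε-closed; ∙-closed; ⁻¹-closed)

    _~_ _≲_ : Rel CosetFace (c ⊔ ℓ ⊔ p)
    F ~ G = ∃ λ m → m ∈ Member × m ▷ F ≃ G
    F ≲ G = ∃ λ m → m ∈ Member × m ▷ F ⊑ G

    ~-refl : ∀ {F} → F ~ F
    ~-refl = ε , ε-closed , rep-cong (identityˡ _)

    ~-sym : ∀ {F G} → F ~ G → G ~ F
    ~-sym {F} {G} (m , m∈ , p) = m ⁻¹ , ⁻¹-closed m∈ ,
      ≃-trans (▷-cong (m ⁻¹) {G} {m ▷ F} (≃-sym p))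
              (rep-cong (\\-leftDividesʳ m (proj₂ F)))

    ~-trans : ∀ {F G K} → F ~ G → G ~ K → F ~ K
    ~-trans {F} {G} (m , m∈ , p) (k , k∈ , q) = k ∙ m , ∙-closed k∈ m∈ ,
      ≃-trans (rep-cong (assoc k m (proj₂ F)))
              (≃-trans (▷-cong k {m ▷ F} {G} p) q)

    ≲-trans : ∀ {F G K} → F ≲ G → G ≲ K → F ≲ K
    ≲-trans {F} {G} {K} (m , m∈ , p) (k , k∈ , q) = k ∙ m , ∙-closed k∈ m∈ ,
      ⊑-trans {(k ∙ m) ▷ F} {k ▷ m ▷ F} {K}
        (⊑-reflexive (rep-cong (assoc k m (proj₂ F))))
        (⊑-trans {k ▷ m ▷ F} {k ▷ G} {K} (▷-mono k {m ▷ F} {G} p) q)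

  baseFlag : ∀ {p} (N : Subgroup group p) → RankedPoset.Flag (quotient N)
  baseFlag N = record
    { face      = λ i → i , ε
    ; face-rank = λ _ → ≡.refl
    ; face-mono = λ {i} {j} i≤j → ε , Subgroup.ε-closed N ,
        i≤j , ε , resp (∙-congʳ (⁻¹-cong (sym (identityˡ ε)))) (coset-self (i , ε)) ,
        coset-self (j , ε)
    }

  -- N is determined as the stabilizer of the base flag: a proper subgroup of
  -- that stabilizer can have the same orbits on faces, hence give the same
  -- quotient poset.
  record ActsOnQuotient {p} (N : Subgroup group p) : Set (c ⊔ ℓ ⊔ p) where
    open RankedPoset (quotient N) using (_≋_)
    open Subgroup N using (Member)
    field
      flagAction : FlagAction group gens (quotient N)
    open FlagAction flagAction
    field
      stabilizer : Member ≐ λ w → baseFlag N · w ≋ baseFlag N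

{-# OPTIONS --safe #-}

-- Polytopes are strongly flag-connected, so W is transitive on the flags of R
-- and on those of P(W)/N.  If w fixes one flag of R then, as automorphisms of R
-- commute with the flag action, w fixes every flag of R; as the covering is
-- equivariant, w then fixes every flag of P(W)/N, so w lies in the core.
-- Fix a flag Φ and send the face of rank i of Φ·w to the coset of w.  This is
-- well defined: if Φ·w and Φ·v share that face, then Φ·w = Φ·v·h with h
-- generated by the s_j, j ≠ i, so w and v h agree modulo the core.

module Submission where

open import Defs
open import Level using (0ℓ; _⊔_)
open import Algebra.Bundles using (Group)
open import Algebra.Morphism.Structures using (IsGroupHomomorphism)
import Algebra.Properties.Group as GroupProperties
open import Data.Fin.Base as Fin using (Fin; toℕ; inject₁; fromℕ<)
import Data.Fin.Properties as Fin
open import Data.List.Base using ([]; _∷_)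
open import Data.List.Relation.Unary.All as All using ([]; _∷_)
open import Data.List.Relation.Unary.AllPairs using ([]; _∷_)
open import Data.Nat.Base as ℕ using (ℕ; zero; suc)
import Data.Nat.Properties as ℕ
open import Data.Product.Base using (∃; _×_; _,_; proj₁; proj₂)
open import Data.Sum.Base using (inj₁; inj₂)
open import Function.Base using (_∘_)
open import Function.Definitions using (StrictlySurjective)
open import Relation.Binary.Bundles using (Setoid)
open import Relation.Binary.Construct.Closure.ReflexiveTransitive
  using (Star; _◅_) renaming (ε to done)
import Relation.Binary.Construct.NonStrictToStrict as ToStrict
open import Relation.Binary.Core using (REL)
open import Relation.Binary.Definitions using (tri<; tri≈; tri>)
open import Relation.Binary.Morphism.Bundles using (PosetHomomorphism; mkPosetHomo)
open import Relation.Binary.PropositionalEquality as ≡ using (_≡_; _≢_)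
import Relation.Binary.Reasoning.Setoid as SetoidReasoning
open import Relation.Nullary.Decidable.Core using (Dec; yes; no)
open import Relation.Nullary.Negation using (¬_; contradiction)
open import Relation.Unary using (Pred; _∈_; _⊆_)

-- Ranks next to a proper rank

below above : ∀ {n} → Fin n → Rank n
below k = inject₁ (inject₁ k)
above k = Fin.suc (Fin.suc k)

toℕ-below : ∀ {n} (k : Fin n) → toℕ (below k) ≡ toℕ k
toℕ-below k = ≡.trans (Fin.toℕ-inject₁ _) (Fin.toℕ-inject₁ k)

toℕ-proper : ∀ {n} (k : Fin n) → toℕ (proper k) ≡ suc (toℕ k)
toℕ-proper k = Fin.toℕ-inject₁ (Fin.suc k)

below<proper : ∀ {n} (k : Fin n) → below k Fin.< proper k
below<proper k = ℕ.≤-reflexive (≡.trans (≡.cong suc (toℕ-below k)) (≡.sym (toℕ-proper k)))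

proper<above : ∀ {n} (k : Fin n) → proper k Fin.< above k
proper<above k = ℕ.≤-reflexive (≡.cong suc (toℕ-proper k))

-- Flags of a ranked poset and splicing

module _ {n a ℓ₁ ℓ₂} (P : RankedPoset n a ℓ₁ ℓ₂) where
  open RankedPoset P
  open ToStrict _≈_ _≤_ using (<-respˡ-≈; <-respʳ-≈)

  flagSetoid : Setoid (a ⊔ ℓ₂) ℓ₁
  flagSetoid = record
    { Carrier       = Flag
    ; _≈_           = _≋_
    ; isEquivalence = record
      { refl  = λ _ → Eq.refl
      ; sym   = λ p i → Eq.sym (p i)
      ; trans = λ p q i → Eq.trans (p i) (q i)
      }
    }

  rank-<⇒< : ∀ {F G} → F ≤ G → rank F Fin.< rank G → F < G
  rank-<⇒< F≤G r<s = F≤G , λ F≈G → Fin.<⇒≢ r<s (rank-cong F≈G)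

  <⇒rank-< : ∀ {F G} → F < G → rank F Fin.< rank G
  <⇒rank-< (F≤G , F≉G) = Fin.≤∧≢⇒< (rank-mono F≤G) (F≉G ∘ rank-injective F≤G)

  face-< : ∀ Φ {i j} → i Fin.< j → face Φ i < face Φ j
  face-< Φ {i} {j} i<j = rank-<⇒< (face-mono Φ (ℕ.<⇒≤ i<j))
    (≡.subst₂ Fin._<_ (≡.sym (face-rank Φ i)) (≡.sym (face-rank Φ j)) i<j)

  between-face : ∀ Φ {i j k} → i Fin.< j → j Fin.< k →
                 Between (face Φ i) (face Φ k) (face Φ j)
  between-face Φ i<j j<k = face-< Φ i<j , face-< Φ j<k

  between-resp : ∀ {F F′ G G′ H} → F ≈ F′ → G ≈ G′ → Between F G H → Between F′ G′ H
  between-resp F≈F′ G≈G′ (F<H , H<G) =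
    <-respˡ-≈ Eq.trans ≤-respˡ-≈ F≈F′ F<H ,
    <-respʳ-≈ Eq.sym Eq.trans ≤-respʳ-≈ G≈G′ H<G

  ∈ᶠ⇒≈ : ∀ {F} Φ → F ∈ᶠ Φ → F ≈ face Φ (rank F)
  ∈ᶠ⇒≈ Φ (i , F≈) with ≡.refl ← ≡.trans (rank-cong F≈) (face-rank Φ i) = F≈

  ∈ᶠ-at : ∀ {F i} Φ → F ∈ᶠ Φ → rank F ≡ i → F ≈ face Φ i
  ∈ᶠ-at Φ F∈ ≡.refl = ∈ᶠ⇒≈ Φ F∈

  module _ (Φ Ψ : Flag) {h : Rank n} (Φₕ≈Ψₕ : face Φ h ≈ face Ψ h) where

    private
      pick : ∀ {i} → Dec (i Fin.≤ h) → Face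
      pick {i} (yes _) = face Φ i
      pick {i} (no _)  = face Ψ i

      pick-rank : ∀ {i} (d : Dec (i Fin.≤ h)) → rank (pick d) ≡ i
      pick-rank (yes _) = face-rank Φ _
      pick-rank (no _)  = face-rank Ψ _

      pick-mono : ∀ {i j} (d : Dec (i Fin.≤ h)) (e : Dec (j Fin.≤ h)) →
                  i Fin.≤ j → pick d ≤ pick e
      pick-mono (yes _)   (yes _)   i≤j = face-mono Φ i≤j
      pick-mono (no _)    (no _)    i≤j = face-mono Ψ i≤j
      pick-mono (no i≰h)  (yes j≤h) i≤j = contradiction (ℕ.≤-trans i≤j j≤h) i≰h
      pick-mono (yes i≤h) (no j≰h)  _   = trans (face-mono Φ i≤h)
        (trans (reflexive Φₕ≈Ψₕ) (face-mono Ψ (ℕ.<⇒≤ (ℕ.≰⇒> j≰h))))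

    -- Faces of Φ up to rank h lie below the common face and faces of Ψ from rank h on lie above it,
    -- so transitivity through that face makes the union a flag. This allows the part of a flag
    -- below a face and the part above it to be changed independently.
    splice : Flag
    splice = record
      { face      = λ i → pick (i Fin.≤? h)
      ; face-rank = λ i → pick-rank (i Fin.≤? h)
      ; face-mono = λ {i} {j} → pick-mono (i Fin.≤? h) (j Fin.≤? h)
      }

    splice-≤ : ∀ {i} → i Fin.≤ h → face splice i ≈ face Φ i
    splice-≤ {i} i≤h with i Fin.≤? h
    ... | yes _  = Eq.refl
    ... | no i≰h = contradiction i≤h i≰h

    splice-≥ : ∀ {i} → h Fin.≤ i → face splice i ≈ face Ψ i
    splice-≥ {i} h≤i with i Fin.≤? h
    ... | no _    = Eq.refl
    -- At rank h itself the splice takes the face of Φ, which is the shared one.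
    ... | yes i≤h with ≡.refl ← Fin.≤-antisym i≤h h≤i = Φₕ≈Ψₕ

  -- The weak inequalities include i and j themselves: both flags pass through the same two faces
  -- bounding the section and can differ only in its proper faces.
  AgreeOutside : Rank n → Rank n → Flag → Flag → Set ℓ₁
  AgreeOutside i j Φ Ψ = (∀ {k} → k Fin.≤ i → face Φ k ≈ face Ψ k) ×
                         (∀ {k} → j Fin.≤ k → face Φ k ≈ face Ψ k)

  agree-sym : ∀ {i j} Φ Ψ → AgreeOutside i j Φ Ψ → AgreeOutside i j Ψ Φ
  agree-sym _ _ (p , q) = Eq.sym ∘ p , Eq.sym ∘ q

  agree-trans : ∀ {i j} Φ Ψ Θ → AgreeOutside i j Φ Ψ → AgreeOutside i j Ψ Θ →
                AgreeOutside i j Φ Θ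
  agree-trans _ _ _ (p , q) (p′ , q′) = (λ k≤ → Eq.trans (p k≤) (p′ k≤)) ,
                                  (λ ≤k → Eq.trans (q ≤k) (q′ ≤k))

  agree⇒≋ : ∀ {i j} Φ Ψ → toℕ j ℕ.≤ suc (toℕ i) → AgreeOutside i j Φ Ψ → Φ ≋ Ψ
  agree⇒≋ {i} _ _ j≤1+i (p , q) k with k Fin.≤? i
  ... | yes k≤i = p k≤i
  ... | no k≰i  = q (ℕ.≤-trans j≤1+i (ℕ.≰⇒> k≰i))

-- Consequences of the polytope axioms

module PolytopeProperties {n a ℓ₁ ℓ₂} {P : RankedPoset n a ℓ₁ ℓ₂} (isPolytope : IsPolytope P) where
  open RankedPoset P
  open IsPolytope isPolytope

  flag-through : ∀ F → ∃ λ Φ → F ≈ face Φ (rank F)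
  flag-through F with flags (F ∷ []) ([] ∷ [])
  ... | Φ , F∈ ∷ [] = Φ , ∈ᶠ⇒≈ P Φ F∈

  -- In any flag, the face of extreme rank is comparable with the least or greatest face and cannot
  -- differ from it in rank, so `rank-injective` identifies the two.
  agree-improper : ∀ Φ Ψ → AgreeOutside P Fin.zero (Fin.fromℕ (suc n)) Φ Ψ
  agree-improper Φ Ψ = bottom , top
    where
    bottom : ∀ {k} → k Fin.≤ Fin.zero {suc n} → face Φ k ≈ face Ψ k
    bottom {Fin.zero} _ = Eq.trans (Eq.sym (atBottom Φ)) (atBottom Ψ)
      where
      atBottom : ∀ Θ → proj₁ least ≈ face Θ Fin.zero
      atBottom Θ = rank-injective L≤ (Fin.≤-antisym (rank-mono L≤)
        (≡.subst (Fin._≤ rank (proj₁ least)) (≡.sym (face-rank Θ Fin.zero)) ℕ.z≤n))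
        where L≤ = proj₂ least (face Θ Fin.zero)

    top : ∀ {k} → Fin.fromℕ (suc n) Fin.≤ k → face Φ k ≈ face Ψ k
    top {k} n≤k = Eq.trans (atTop Φ) (Eq.sym (atTop Ψ))
      where
      atTop : ∀ Θ → face Θ k ≈ proj₁ greatest
      atTop Θ = rank-injective ≤G (Fin.≤-antisym (rank-mono ≤G)
        (≡.subst (rank (proj₁ greatest) Fin.≤_) (≡.sym (face-rank Θ k))
          (ℕ.≤-trans (Fin.≤fromℕ (rank (proj₁ greatest))) n≤k)))
        where ≤G = proj₂ greatest (face Θ k)

  module _ (Φ : Flag) (k : Fin n) where
    private
      Middle : Pred Face _
      Middle = Between (face Φ (below k)) (face Φ (above k))

      middle = diamond (face-mono Φ (ℕ.<⇒≤ (ℕ.<-trans (below<proper k) (proper<above k))))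
        (≡.trans (≡.cong toℕ (face-rank Φ (above k)))
          (≡.cong (2 ℕ.+_) (≡.sym (≡.trans (≡.cong toℕ (face-rank Φ (below k))) (toℕ-below k)))))

    -- Equality of arbitrary faces need not be decidable. Inside a diamond it is, since each face
    -- comes with the information which of the two middle faces it equals.
    middle-≟ : ∀ {X Y} → X ∈ Middle → Y ∈ Middle → Dec (X ≈ Y)
    middle-≟ X∈ Y∈ with middle
    ... | _ , _ , H≉ , _ , _ , cover with cover _ X∈ | cover _ Y∈
    ... | inj₁ x | inj₁ y = yes (Eq.trans x (Eq.sym y))
    ... | inj₂ x | inj₂ y = yes (Eq.trans x (Eq.sym y))
    ... | inj₁ x | inj₂ y = no λ e → H≉ (Eq.trans (Eq.sym x) (Eq.trans e y))
    ... | inj₂ x | inj₁ y = no λ e → H≉ (Eq.sym (Eq.trans (Eq.sym x) (Eq.trans e y)))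

    middle-unique : ∀ {X Y Z} → X ∈ Middle → Y ∈ Middle → Z ∈ Middle →
                    ¬ (X ≈ Y) → ¬ (X ≈ Z) → Y ≈ Z
    middle-unique X∈ Y∈ Z∈ X≉Y X≉Z with middle
    ... | _ , _ , _ , _ , _ , cover with cover _ X∈ | cover _ Y∈ | cover _ Z∈
    ... | _      | inj₁ y | inj₁ z = Eq.trans y (Eq.sym z)
    ... | _      | inj₂ y | inj₂ z = Eq.trans y (Eq.sym z)
    ... | inj₁ x | inj₁ y | inj₂ _ = contradiction (Eq.trans x (Eq.sym y)) X≉Y
    ... | inj₁ x | inj₂ _ | inj₁ z = contradiction (Eq.trans x (Eq.sym z)) X≉Z
    ... | inj₂ x | inj₁ _ | inj₂ z = contradiction (Eq.trans x (Eq.sym z)) X≉Z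
    ... | inj₂ x | inj₂ y | inj₁ _ = contradiction (Eq.trans x (Eq.sym y)) X≉Y

    self-middle : face Φ (proper k) ∈ Middle
    self-middle = between-face P Φ (below<proper k) (proper<above k)

    adjacent-middle : ∀ {Ψ} → (∀ j → j ≢ proper k → face Φ j ≈ face Ψ j) →
                      face Ψ (proper k) ∈ Middle
    adjacent-middle {Ψ} agree = between-resp P
      (Eq.sym (agree (below k) (Fin.<⇒≢ (below<proper k))))
      (Eq.sym (agree (above k) (Fin.<⇒≢ (proper<above k) ∘ ≡.sym)))
      (between-face P Ψ (below<proper k) (proper<above k))

  adjacent-unique : ∀ {k Φ Ψ Θ} → Adjacent k Φ Ψ → Adjacent k Φ Θ → Ψ ≋ Θ
  adjacent-unique {k} {Φ} {Ψ} {Θ} (p , ≉Ψ) (q , ≉Θ) j with j Fin.≟ proper k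
  ... | no j≢k     = Eq.trans (Eq.sym (p j j≢k)) (q j j≢k)
  ... | yes ≡.refl = middle-unique Φ k (self-middle Φ k)
    (adjacent-middle Φ k {Ψ} p) (adjacent-middle Φ k {Θ} q) ≉Ψ ≉Θ

-- Subgroups generated by subsets of the generators

module Generation {c ℓ} (G : Group c ℓ) where
  open Group G

  ⟨⟩-mono : ∀ {n} {s : Fin n → Carrier} {I J} → I ⊆ J → ⟨_⟩ G s I ⊆ ⟨_⟩ G s J
  ⟨⟩-mono I⊆J (gen i∈)   = gen (I⊆J i∈)
  ⟨⟩-mono I⊆J unit       = unit
  ⟨⟩-mono I⊆J (mult p q) = mult (⟨⟩-mono I⊆J p) (⟨⟩-mono I⊆J q)
  ⟨⟩-mono I⊆J (inv p)    = inv (⟨⟩-mono I⊆J p)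
  ⟨⟩-mono I⊆J (resp e p) = resp e (⟨⟩-mono I⊆J p)

  ⟨∅⟩-trivial : ∀ {n} {s : Fin n → Carrier} {J} → (∀ j → ¬ J j) →
                ∀ {g} → g ∈ ⟨_⟩ G s J → g ≈ ε
  ⟨∅⟩-trivial ∅ (gen j∈)   = contradiction j∈ (∅ _)
  ⟨∅⟩-trivial ∅ unit       = refl
  ⟨∅⟩-trivial ∅ (mult p q) = trans (∙-cong (⟨∅⟩-trivial ∅ p) (⟨∅⟩-trivial ∅ q)) (identityˡ ε)
  ⟨∅⟩-trivial ∅ (inv p)    = trans (⁻¹-cong (⟨∅⟩-trivial ∅ p)) (GroupProperties.ε⁻¹≈ε G)
  ⟨∅⟩-trivial ∅ (resp e p) = trans (sym e) (⟨∅⟩-trivial ∅ p)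

  -- The intersection property for {k} and J would put s_k into the subgroup generated by the empty
  -- set, which is trivial.
  generator-∉ : ∀ {n} {s : Fin n → Carrier} → IsStringCGroup G s →
                ∀ k {J} → ¬ J k → ¬ (s k ∈ ⟨_⟩ G s J)
  generator-∉ isC k {J} k∉J sk∈ = nontrivial k (⟨∅⟩-trivial
    (λ { _ (≡.refl , k∈J) → k∉J k∈J })
    (proj₁ (intersection (_≡ k) J) (gen ≡.refl , sk∈)))
    where open IsStringCGroup isC

-- Flag actions

module ActionProperties {n c ℓ a ℓ₁ ℓ₂} {G : Group c ℓ} {s : Fin n → Group.Carrier G}
                        {P : RankedPoset n a ℓ₁ ℓ₂} (A : FlagAction G s P) where
  open RankedPoset P using (Flag; _≋_; module Eq)
  open Group G
  open FlagAction A
  open SetoidReasoning (flagSetoid P)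

  ·-congʳ : ∀ {Φ Ψ} g → Φ ≋ Ψ → Φ · g ≋ Ψ · g
  ·-congʳ {Φ} {Ψ} g eq = ·-cong {Φ} {Ψ} eq refl

  ·-congˡ : ∀ Φ {g h} → g ≈ h → Φ · g ≋ Φ · h
  ·-congˡ Φ = ·-cong {Φ} {Φ} (λ _ → Eq.refl)

  ·-⁻¹ʳ : ∀ Φ g → Φ · g · g ⁻¹ ≋ Φ
  ·-⁻¹ʳ Φ g = begin
    Φ · g · g ⁻¹    ≈⟨ ·-∙ Φ g (g ⁻¹) ⟨
    Φ · (g ∙ g ⁻¹)  ≈⟨ ·-congˡ Φ (inverseʳ g) ⟩
    Φ · ε           ≈⟨ ·-ε Φ ⟩
    Φ               ∎

  conjugate-fixes : ∀ Φ w k → Φ · w · k ≋ Φ · w → Φ · (w ∙ k ∙ w ⁻¹) ≋ Φ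
  conjugate-fixes Φ w k fix = begin
    Φ · (w ∙ k ∙ w ⁻¹)   ≈⟨ ·-∙ Φ (w ∙ k) (w ⁻¹) ⟩
    Φ · (w ∙ k) · w ⁻¹   ≈⟨ ·-congʳ {Φ · (w ∙ k)} {Φ · w · k} (w ⁻¹) (·-∙ Φ w k) ⟩
    Φ · w · k · w ⁻¹     ≈⟨ ·-congʳ {Φ · w · k} {Φ · w} (w ⁻¹) fix ⟩
    Φ · w · w ⁻¹         ≈⟨ ·-⁻¹ʳ Φ w ⟩
    Φ                    ∎

  \\-fixes : ∀ Φ x y → Φ · x ≋ Φ · y → Φ · x · (x ⁻¹ ∙ y) ≋ Φ · x
  \\-fixes Φ x y eq = begin
    Φ · x · (x ⁻¹ ∙ y)   ≈⟨ ·-∙ (Φ · x) (x ⁻¹) y ⟩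
    Φ · x · x ⁻¹ · y     ≈⟨ ·-congʳ {Φ · x · x ⁻¹} {Φ} y (·-⁻¹ʳ Φ x) ⟩
    Φ · y                ≈⟨ eq ⟨
    Φ · x                ∎

  infix 4 _⟶[_]_

  _⟶[_]_ : Flag → Pred (Fin n) 0ℓ → Flag → Set (c ⊔ ℓ ⊔ ℓ₁)
  Φ ⟶[ J ] Ψ = ∃ λ g → g ∈ ⟨_⟩ G s J × Φ · g ≋ Ψ

  ≋⇒⟶ : ∀ {J} Φ Ψ → Φ ≋ Ψ → Φ ⟶[ J ] Ψ
  ≋⇒⟶ Φ Ψ eq = ε , unit , λ i → Eq.trans (·-ε Φ i) (eq i)

  ⟶-trans : ∀ {J} Φ Ψ Θ → Φ ⟶[ J ] Ψ → Ψ ⟶[ J ] Θ → Φ ⟶[ J ] Θ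
  ⟶-trans Φ Ψ Θ (g , g∈ , p) (h , h∈ , q) = g ∙ h , mult g∈ h∈ , (begin
    Φ · (g ∙ h)  ≈⟨ ·-∙ Φ g h ⟩
    Φ · g · h    ≈⟨ ·-congʳ {Φ · g} {Ψ} h p ⟩
    Ψ · h        ≈⟨ q ⟩
    Θ            ∎)

  ⟶-mono : ∀ {I J} Φ Ψ → I ⊆ J → Φ ⟶[ I ] Ψ → Φ ⟶[ J ] Ψ
  ⟶-mono _ _ I⊆J (g , g∈ , p) = g , Generation.⟨⟩-mono G I⊆J g∈ , p

-- Strong flag-connectedness

module Connectedness {n c ℓ a ℓ₁ ℓ₂} {G : Group c ℓ} {s : Fin n → Group.Carrier G}
                     {P : RankedPoset n a ℓ₁ ℓ₂} (isPolytope : IsPolytope P)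
                     (A : FlagAction G s P) where
  open RankedPoset P
  open IsPolytope isPolytope
  open PolytopeProperties isPolytope
  open FlagAction A
  open ActionProperties A

  Inside : Rank n → Rank n → Pred (Fin n) 0ℓ
  Inside i j k = i Fin.< proper k × proper k Fin.< j

  agree-off : ∀ k Φ Ψ → AgreeOutside P (below k) (above k) Φ Ψ →
              ∀ j → j ≢ proper k → face Φ j ≈ face Ψ j
  agree-off k Φ Ψ (p , q) j j≢ with Fin.<-cmp j (proper k)
  ... | tri≈ _ j≡ _ = contradiction j≡ j≢
  ... | tri< j< _ _ = p (ℕ.≤-trans (ℕ.≤-pred (≡.subst (toℕ j ℕ.<_) (toℕ-proper k) j<))
                                   (ℕ.≤-reflexive (≡.sym (toℕ-below k))))
  ... | tri> _ _ j> = q (≡.subst (ℕ._< toℕ j) (toℕ-proper k) j>)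

  -- By the diamond condition Ψ is either Φ or its unique k-adjacent flag, which is Φ · s_k;
  -- `middle-≟` decides which.
  connect-adjacent : ∀ {J} k Φ Ψ → k ∈ J → AgreeOutside P (below k) (above k) Φ Ψ →
                     Φ ⟶[ J ] Ψ
  connect-adjacent k Φ Ψ k∈ agree
    with off ← agree-off k Φ Ψ agree
    with middle-≟ Φ k (self-middle Φ k) (adjacent-middle Φ k {Ψ} off)
  ... | no neq = s k , gen k∈ , adjacent-unique {k} {Φ} {Φ · s k} {Ψ} (·-gen Φ k) (off , neq)
  ... | yes eq = ≋⇒⟶ Φ Ψ same
    where
    same : Φ ≋ Ψ
    same j with j Fin.≟ proper k
    ... | yes ≡.refl = eq
    ... | no j≢      = off j j≢

  -- Strong flag-connectedness, by induction on a bound d for j − i: `connect-at` splices at a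
  -- shared face of rank h, and `connect-star` walks along a path of proper faces of the section.
  connect : ∀ d {i j} Φ Ψ → toℕ j ℕ.≤ d ℕ.+ toℕ i → AgreeOutside P i j Φ Ψ →
            Φ ⟶[ Inside i j ] Ψ

  connect-at : ∀ d {i j h} Φ Ψ → toℕ j ℕ.≤ suc d ℕ.+ toℕ i → AgreeOutside P i j Φ Ψ →
               i Fin.< h → h Fin.< j → face Φ h ≈ face Ψ h → Φ ⟶[ Inside i j ] Ψ

  -- F and G are kept apart from the faces of Φ because the flag changes along a path while the
  -- section containing the path must stay fixed.
  connect-through : ∀ d {i j F G H} Φ Ψ → toℕ j ℕ.≤ suc d ℕ.+ toℕ i → AgreeOutside P i j Φ Ψ →
                    face Φ i ≈ F → face Φ j ≈ G → Between F G H →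
                    H ∈ᶠ Φ → H ∈ᶠ Ψ → Φ ⟶[ Inside i j ] Ψ

  connect-star : ∀ d {i j F G} Φ Ψ → toℕ j ℕ.≤ suc d ℕ.+ toℕ i → AgreeOutside P i j Φ Ψ →
                 face Φ i ≈ F → face Φ j ≈ G →
                 ∀ {H K} → proj₁ H ∈ᶠ Φ → proj₁ K ∈ᶠ Ψ →
                 Star (IncidentBetween F G) H K → Φ ⟶[ Inside i j ] Ψ

  connect-at d {i} {j} {h} Φ Ψ j≤ (p , q) i<h h<j eq =
    -- Θ follows Φ up to rank h and Ψ from there on. Cutting at h lowers the bound on both sides: i
    -- < h gives j ≤ d + h, and h < j gives h ≤ d + i.
    ⟶-trans Φ Θ Ψ
      (⟶-mono Φ Θ (λ (h<k , k<j) → ℕ.<-trans i<h h<k , k<j) (connect d Φ Θ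
        (ℕ.≤-trans j≤ (≡.subst (ℕ._≤ d ℕ.+ toℕ h) (ℕ.+-suc d (toℕ i)) (ℕ.+-monoʳ-≤ d i<h)))
        ((λ k≤h → Eq.sym (splice-≤ P Φ Ψ eq k≤h)) ,
         (λ j≤k → Eq.trans (q j≤k) (Eq.sym (splice-≥ P Φ Ψ eq (ℕ.≤-trans (ℕ.<⇒≤ h<j) j≤k)))))))
      (⟶-mono Θ Ψ (λ (i<k , k<h) → i<k , ℕ.<-trans k<h h<j) (connect d Θ Ψ
        (ℕ.≤-pred (ℕ.≤-trans h<j j≤))
        ((λ k≤i → Eq.trans (splice-≤ P Φ Ψ eq (ℕ.≤-trans k≤i (ℕ.<⇒≤ i<h))) (p k≤i)) ,
         (λ h≤k → splice-≥ P Φ Ψ eq h≤k))))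
    where Θ = splice P Φ Ψ eq

  connect-through d {i} {j} {H = H} Φ Ψ j≤ agree Φᵢ≈F Φⱼ≈G (F<H , H<G) H∈Φ H∈Ψ =
    connect-at d Φ Ψ j≤ agree
      (≡.subst (Fin._< rank H) F-rank (<⇒rank-< P F<H))
      (≡.subst (rank H Fin.<_) G-rank (<⇒rank-< P H<G))
      (Eq.trans (Eq.sym (∈ᶠ⇒≈ P Φ H∈Φ)) (∈ᶠ⇒≈ P Ψ H∈Ψ))
    where
    F-rank = ≡.trans (rank-cong (Eq.sym Φᵢ≈F)) (face-rank Φ i)
    G-rank = ≡.trans (rank-cong (Eq.sym Φⱼ≈G)) (face-rank Φ j)

  connect-star d Φ Ψ j≤ agree Φᵢ≈F Φⱼ≈G {H = _ , H∈} H∈Φ H∈Ψ done =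
    connect-through d Φ Ψ j≤ agree Φᵢ≈F Φⱼ≈G H∈ H∈Φ H∈Ψ
  connect-star d {i} {j} {F} {G} Φ Ψ j≤ agree Φᵢ≈F Φⱼ≈G {H , F<H , H<G} {K} H∈Φ K∈Ψ
    (_◅_ {j = L , F<L , L<G} H~L L⋯K)
    -- The first edge of the path makes F, H, L, G a chain, so a flag Ξ contains all four.
    with flags (F ∷ H ∷ L ∷ G ∷ [])
           ((inj₁ (proj₁ F<H) ∷ inj₁ (proj₁ F<L) ∷ inj₁ (trans (proj₁ F<H) (proj₁ H<G)) ∷ []) ∷
            (H~L ∷ inj₁ (proj₁ H<G) ∷ []) ∷
            (inj₁ (proj₁ L<G) ∷ []) ∷ [] ∷ [])
  ... | Ξ , F∈ ∷ H∈ ∷ L∈ ∷ G∈ ∷ [] =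
    -- Θ contains both H and L: it is reached from Φ through the common face H, and the remaining
    -- path starts at its face L.
    ⟶-trans Φ Θ Ψ
      (connect-through d Φ Θ j≤ Φ~Θ Φᵢ≈F Φⱼ≈G (F<H , H<G) H∈Φ (inΘ H F<H H<G H∈))
      (connect-star d Θ Ψ j≤ (agree-trans P Θ Φ Ψ (agree-sym P Φ Θ Φ~Θ) agree)
        (Eq.trans (Eq.sym (proj₁ Φ~Θ ℕ.≤-refl)) Φᵢ≈F)
        (Eq.trans (Eq.sym (proj₂ Φ~Θ ℕ.≤-refl)) Φⱼ≈G)
        (inΘ L F<L L<G L∈) K∈Ψ L⋯K)
    where
    F-rank : rank F ≡ i
    F-rank = ≡.trans (rank-cong (Eq.sym Φᵢ≈F)) (face-rank Φ i)
    G-rank : rank G ≡ j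
    G-rank = ≡.trans (rank-cong (Eq.sym Φⱼ≈G)) (face-rank Φ j)
    i≤j : i Fin.≤ j
    i≤j = ≡.subst₂ Fin._≤_ F-rank G-rank (rank-mono (trans (proj₁ F<H) (proj₁ H<G)))
    Φᵢ≈Ξᵢ = Eq.trans Φᵢ≈F (∈ᶠ-at P Ξ F∈ F-rank)
    -- Two splices, at ranks i and j, replace the part of Φ inside the section by that of Ξ.
    Λ = splice P Φ Ξ Φᵢ≈Ξᵢ
    Λⱼ≈Φⱼ = Eq.trans (splice-≥ P Φ Ξ Φᵢ≈Ξᵢ i≤j)
              (Eq.trans (Eq.sym (∈ᶠ-at P Ξ G∈ G-rank)) (Eq.sym Φⱼ≈G))
    Θ = splice P Λ Φ Λⱼ≈Φⱼ
    Φ~Θ : AgreeOutside P i j Φ Θ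
    Φ~Θ = (λ k≤i → Eq.sym (Eq.trans (splice-≤ P Λ Φ Λⱼ≈Φⱼ (ℕ.≤-trans k≤i i≤j))
                                    (splice-≤ P Φ Ξ Φᵢ≈Ξᵢ k≤i))) ,
          (λ j≤k → Eq.sym (splice-≥ P Λ Φ Λⱼ≈Φⱼ j≤k))
    inΘ : ∀ X → F < X → X < G → X ∈ᶠ Ξ → X ∈ᶠ Θ
    inΘ X F<X X<G X∈ = rank X , Eq.trans (∈ᶠ⇒≈ P Ξ X∈) (Eq.sym (Eq.trans
      (splice-≤ P Λ Φ Λⱼ≈Φⱼ (≡.subst (rank X Fin.≤_) G-rank (rank-mono (proj₁ X<G))))
      (splice-≥ P Φ Ξ Φᵢ≈Ξᵢ (≡.subst (Fin._≤ rank X) F-rank (rank-mono (proj₁ F<X))))))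

  connect zero Φ Ψ j≤ agree = ≋⇒⟶ Φ Ψ (agree⇒≋ P Φ Ψ (ℕ.m≤n⇒m≤1+n j≤) agree)
  -- For j < i + 2 no rank lies strictly between. For j = i + 2 there is exactly one, and the
  -- diamond condition applies. From j = i + 3 on the section has rank at least 2 and is connected.
  connect (suc d) {i} {j} Φ Ψ j≤ agree with ℕ.<-cmp (toℕ j) (2 ℕ.+ toℕ i)
  ... | tri< j<2+i _ _ = ≋⇒⟶ Φ Ψ (agree⇒≋ P Φ Ψ (ℕ.≤-pred j<2+i) agree)
  ... | tri> _ _ 3+i≤j =
    connect-star d Φ Ψ j≤ agree Eq.refl Eq.refl
      (h , Eq.refl) (h , Eq.refl)
      (stronglyConnected (face-mono Φ (ℕ.<⇒≤ (Fin.<-trans {i = i} {h} {j} i<h h<j)))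
        (≡.subst₂ (λ x y → 3 ℕ.+ toℕ x ℕ.≤ toℕ y)
          (≡.sym (face-rank Φ i)) (≡.sym (face-rank Φ j)) 3+i≤j)
        (face Φ h , between-face P Φ i<h h<j)
        (face Ψ h , between-resp P (Eq.sym (proj₁ agree ℕ.≤-refl)) (Eq.sym (proj₂ agree ℕ.≤-refl))
                      (between-face P Ψ i<h h<j)))
    where
    1+i<j : suc (toℕ i) ℕ.< toℕ j
    1+i<j = ℕ.<⇒≤ 3+i≤j
    -- The path is taken between the faces of rank i + 1 of the two flags; any rank strictly between
    -- i and j would serve.
    h = fromℕ< (ℕ.<-trans 1+i<j (Fin.toℕ<n j))
    h≡ : toℕ h ≡ suc (toℕ i)
    h≡ = Fin.toℕ-fromℕ< (ℕ.<-trans 1+i<j (Fin.toℕ<n j))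
    i<h : i Fin.< h
    i<h = ℕ.≤-reflexive (≡.sym h≡)
    h<j : h Fin.< j
    h<j = ≡.subst (ℕ._< toℕ j) (≡.sym h≡) 1+i<j
  ... | tri≈ _ j≡2+i _ = connect-adjacent k Φ Ψ
    (≡.subst (Fin._< proper k) i≡ (below<proper k) , ≡.subst (proper k Fin.<_) j≡ (proper<above k))
    (≡.subst₂ (λ x y → AgreeOutside P x y Φ Ψ) (≡.sym i≡) (≡.sym j≡) agree)
    where
    k : Fin n
    -- The only rank strictly between is i + 1; since `proper` shifts by one, its generator has the
    -- number of i itself.
    k = fromℕ< (ℕ.≤-pred (ℕ.≤-pred (≡.subst (ℕ._< 2 ℕ.+ n) j≡2+i (Fin.toℕ<n j))))
    k≡ : toℕ k ≡ toℕ i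
    k≡ = Fin.toℕ-fromℕ< _
    i≡ : below k ≡ i
    i≡ = Fin.toℕ-injective (≡.trans (toℕ-below k) k≡)
    j≡ : above k ≡ j
    j≡ = Fin.toℕ-injective (≡.trans (≡.cong (2 ℕ.+_) k≡) (≡.sym j≡2+i))

  -- Going through the splice at i changes first only ranks above i and then only ranks below i, so
  -- the generator of rank i never occurs. The bound 2 + n exceeds every rank index.
  connect-sharing : ∀ i Φ Ψ → face Φ i ≈ face Ψ i → Φ ⟶[ (λ k → proper k ≢ i) ] Ψ
  connect-sharing i Φ Ψ eq = ⟶-trans Φ Θ Ψ
    (⟶-mono Φ Θ (λ (i<k , _) → Fin.<⇒≢ i<k ∘ ≡.sym) (connect (2 ℕ.+ n) Φ Θ
      (ℕ.m≤n⇒m≤n+o (toℕ i) (ℕ.<⇒≤ (Fin.toℕ<n (Fin.fromℕ (suc n)))))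
      ((λ k≤i → Eq.sym (splice-≤ P Φ Ψ eq k≤i)) , proj₂ (agree-improper Φ Θ))))
    (⟶-mono Θ Ψ (λ (_ , k<i) → Fin.<⇒≢ k<i) (connect (2 ℕ.+ n) {Fin.zero} Θ Ψ
      (ℕ.m≤n⇒m≤n+o 0 (ℕ.<⇒≤ (Fin.toℕ<n i)))
      (proj₁ (agree-improper Θ Ψ) , λ i≤k → splice-≥ P Φ Ψ eq i≤k)))
    where Θ = splice P Φ Ψ eq

  -- Any two flags share the least face.
  flag-transitive : ∀ Φ Ψ → ∃ λ g → Φ · g ≋ Ψ
  flag-transitive Φ Ψ =
    let g , _ , eq = connect-sharing Fin.zero Φ Ψ (proj₁ (agree-improper Φ Ψ) ℕ.z≤n)
    in g , eq

-- Equivariance of coverings and automorphisms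

module Equivariance {n c ℓ} (W : StringCGroup n c ℓ) {a ℓ₁ ℓ₂ b ℓ₃ ℓ₄}
                    {P : RankedPoset n a ℓ₁ ℓ₂} {Q : RankedPoset n b ℓ₃ ℓ₄}
                    (A : FlagAction (StringCGroup.group W) (StringCGroup.gens W) P)
                    (B : FlagAction (StringCGroup.group W) (StringCGroup.gens W) Q) where
  private
    module P = RankedPoset P
    module Q = RankedPoset Q
    module A = FlagAction A
    module B = FlagAction B
  open StringCGroup W
  open Group group
  open GroupProperties group
  open IsStringCGroup isStringCGroup

  module _ {t} (_∼_ : REL P.Flag Q.Flag t)
           (respects : ∀ {Φ Φ′ Ψ Ψ′} → Φ P.≋ Φ′ → Ψ Q.≋ Ψ′ → Φ ∼ Ψ → Φ′ ∼ Ψ′)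
           (step : ∀ {Φ Ψ} i → Φ ∼ Ψ → (Φ A.· gens i) ∼ (Ψ B.· gens i)) where

    private
      Preserves : Pred Carrier _
      Preserves g = ∀ {Φ Ψ} → Φ ∼ Ψ → (Φ A.· g) ∼ (Ψ B.· g)

      preserves-resp : ∀ {g h} → g ≈ h → Preserves g → Preserves h
      preserves-resp g≈h p {Φ} {Ψ} r = respects
        (ActionProperties.·-congˡ A Φ g≈h) (ActionProperties.·-congˡ B Ψ g≈h) (p r)

      preserves-ε : Preserves ε
      preserves-ε {Φ} {Ψ} = respects
        (Setoid.sym (flagSetoid P) {Φ A.· ε} {Φ} (A.·-ε Φ))
        (Setoid.sym (flagSetoid Q) {Ψ B.· ε} {Ψ} (B.·-ε Ψ))

      preserves-∙ : ∀ g h → Preserves g → Preserves h → Preserves (g ∙ h)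
      preserves-∙ g h p q {Φ} {Ψ} r = respects
        (Setoid.sym (flagSetoid P) {Φ A.· (g ∙ h)} {Φ A.· g A.· h} (A.·-∙ Φ g h))
        (Setoid.sym (flagSetoid Q) {Ψ B.· (g ∙ h)} {Ψ B.· g B.· h} (B.·-∙ Ψ g h))
        (q (p r))

      -- The inverse is carried along because the case `inv` could not be derived from preservation
      -- by g alone. For a generator both halves coincide, as it is an involution.
      preserves : ∀ {J g} → g ∈ ⟨_⟩ group gens J → Preserves g × Preserves (g ⁻¹)
      preserves (gen {i} _) =
        step i , preserves-resp (inverseˡ-unique _ _ (involutive i)) (step i)
      preserves unit = preserves-ε , preserves-resp (sym ε⁻¹≈ε) preserves-ε
      preserves (mult {x} {y} x∈ y∈) with preserves x∈ | preserves y∈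
      ... | p , p′ | q , q′ = preserves-∙ x y p q ,
        preserves-resp (sym (⁻¹-anti-homo-∙ x y)) (preserves-∙ (y ⁻¹) (x ⁻¹) q′ p′)
      preserves (inv {x} x∈) with preserves x∈
      ... | p , p′ = p′ , preserves-resp (sym (⁻¹-involutive x)) p
      preserves (resp e x∈) with preserves x∈
      ... | p , p′ = preserves-resp e p , preserves-resp (⁻¹-cong e) p′

    -- The generators generate W, so the single steps suffice. An arbitrary relation serves both
    -- coverings, acting on flags through `mapFlag`, and automorphisms, acting face by face.
    equivariant : ∀ g {Φ Ψ} → Φ ∼ Ψ → (Φ A.· g) ∼ (Ψ B.· g)
    equivariant g = proj₁ (preserves (generates g))

module _ {n c ℓ} (W : StringCGroup n c ℓ) {a ℓ₁ ℓ₂ b ℓ₃ ℓ₄}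
         {P : RankedPoset n a ℓ₁ ℓ₂} {Q : RankedPoset n b ℓ₃ ℓ₄}
         (isPolytope : IsPolytope Q) (η : P Covers Q)
         (A : FlagAction (StringCGroup.group W) (StringCGroup.gens W) P)
         (B : FlagAction (StringCGroup.group W) (StringCGroup.gens W) Q) where
  private
    module P = RankedPoset P
    module Q = RankedPoset Q
    module A = FlagAction A
    module B = FlagAction B
  open StringCGroup W using (gens)
  open Covering η using (cong; mapFlag; adjacency-preserving)
  open PolytopeProperties isPolytope

  -- A covering sends Φ · s_k to a flag k-adjacent to the image of Φ, and in the polytope Q there is
  -- only one such flag.
  covering-equivariant : ∀ g {Φ Ψ} → mapFlag Φ Q.≋ Ψ → mapFlag (Φ A.· g) Q.≋ (Ψ B.· g)
  covering-equivariant =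
    Equivariance.equivariant W A B (λ Φ Ψ → mapFlag Φ Q.≋ Ψ)
      (λ Φ≋Φ′ Ψ≋Ψ′ r i → Q.Eq.trans (cong (P.Eq.sym (Φ≋Φ′ i))) (Q.Eq.trans (r i) (Ψ≋Ψ′ i)))
      (λ {Φ} {Ψ} k r → Setoid.trans (flagSetoid Q)
        {mapFlag (Φ A.· gens k)} {mapFlag Φ B.· gens k} {Ψ B.· gens k}
        (adjacent-unique {k} {mapFlag Φ} {mapFlag (Φ A.· gens k)} {mapFlag Φ B.· gens k}
          (adjacency-preserving {k} {Φ} {Φ A.· gens k} (A.·-gen Φ k))
          (B.·-gen (mapFlag Φ) k))
        (ActionProperties.·-congʳ B {mapFlag Φ} {Ψ} (gens k) r))

module _ {n c ℓ} (W : StringCGroup n c ℓ) {a ℓ₁ ℓ₂} {P : RankedPoset n a ℓ₁ ℓ₂}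
         (A : FlagAction (StringCGroup.group W) (StringCGroup.gens W) P) where
  open StringCGroup W using (gens)
  open RankedPoset P
  open FlagAction A

  module _ (isPolytope : IsPolytope P) (γ : Automorphism P) where
    open Automorphism γ
    open PolytopeProperties isPolytope
    private
      module to   = PosetHomomorphism to
      module from = PosetHomomorphism from

    apply-injective : ∀ {F G} → apply F ≈ apply G → F ≈ G
    apply-injective eq = Eq.trans (Eq.sym (inverseʳ _)) (Eq.trans (from.cong eq) (inverseʳ _))

    apply-< : ∀ {F G} → F < G → apply F < apply G
    apply-< (F≤G , F≉G) = to.mono F≤G , F≉G ∘ apply-injective

    -- At rank k, the image of the new face of Φ lies in the same diamond as the face of Ψ and
    -- differs from it by injectivity, so it is the other middle face. The argument runs on faces
    -- because rank preservation is not a field of `Automorphism`.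
    automorphism-adjacent :
      ∀ {Φ Ψ} k → (∀ i → apply (face Φ i) ≈ face Ψ i) →
      ∀ i → apply (face (Φ · gens k) i) ≈ face (Ψ · gens k) i
    automorphism-adjacent {Φ} {Ψ} k r i with i Fin.≟ proper k | ·-gen Φ k | ·-gen Ψ k
    ... | no i≢k     | p , _  | q , _ =
      Eq.trans (to.cong (Eq.sym (p i i≢k))) (Eq.trans (r i) (q i i≢k))
    ... | yes ≡.refl | p , ≉Φ | q , ≉Ψ
      with F<H , H<G ← adjacent-middle Φ k {Φ · gens k} p =
      middle-unique Ψ k (self-middle Ψ k)
        (between-resp P (r (below k)) (r (above k)) (apply-< F<H , apply-< H<G))
        (adjacent-middle Ψ k {Ψ · gens k} q)
        (λ eq → ≉Φ (apply-injective (Eq.trans (r i) eq))) ≉Ψ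

    automorphism-equivariant :
      ∀ g {Φ Ψ} → (∀ i → apply (face Φ i) ≈ face Ψ i) →
      ∀ i → apply (face (Φ · g) i) ≈ face (Ψ · g) i
    automorphism-equivariant =
      Equivariance.equivariant W A A (λ Φ Ψ → ∀ i → apply (face Φ i) ≈ face Ψ i)
        (λ Φ≋Φ′ Ψ≋Ψ′ r i → Eq.trans (to.cong (Eq.sym (Φ≋Φ′ i))) (Eq.trans (r i) (Ψ≋Ψ′ i)))
        automorphism-adjacent

  fixes-all : IsRegularPolytope P → ∀ Φ Ψ g → Φ · g ≋ Φ → Ψ · g ≋ Ψ
  fixes-all isRegular Φ Ψ g fix i with γ , γΦ≋Ψ ← IsRegularPolytope.flagTransitive isRegular Φ Ψ =
    Eq.trans
      (Eq.sym (automorphism-equivariant (IsRegularPolytope.isPolytope isRegular) γ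
                g {Φ} {Ψ} γΦ≋Ψ i))
      (Eq.trans (PosetHomomorphism.cong (Automorphism.to γ) (fix i)) (γΦ≋Ψ i))

-- Flag stabilizers in R lie in the core

module _ {n c ℓ p} (W : StringCGroup n c ℓ) {N : Subgroup (StringCGroup.group W) p}
         (isPolytope : IsPolytope (quotient W N)) (acts : ActsOnQuotient W N)
         {a ℓ₁ ℓ₂} {R : RankedPoset n a ℓ₁ ℓ₂} (isRegular : IsRegularPolytope R)
         (η : R Covers quotient W N)
         (A : FlagAction (StringCGroup.group W) (StringCGroup.gens W) R) where
  private
    module R = RankedPoset R
    module Q = RankedPoset (quotient W N)
  open StringCGroup W
  open Group group
  open GroupProperties group
  open SetoidReasoning setoid
  open ActsOnQuotient acts
  open Covering η using (cong; mapFlag)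
  open FlagAction A
  private module B = FlagAction flagAction

  -- Every flag Ψ of the quotient lifts to R: if v takes the image of Φ to Ψ, then Φ · v maps to Ψ
  -- by equivariance. Now g fixes Φ · v, hence also its image.
  fixes-quotient : ∀ Φ g → Φ · g R.≋ Φ → ∀ Ψ → Ψ B.· g Q.≋ Ψ
  fixes-quotient Φ g fix Ψ i =
    Q.Eq.trans (Q.Eq.sym (η-equivariant g {Φ · v} {Ψ} η[Φv]≋Ψ i))
      (Q.Eq.trans (cong (fixes-all W A isRegular Φ (Φ · v) g fix i)) (η[Φv]≋Ψ i))
    where
    η-equivariant = covering-equivariant W isPolytope η A flagAction
    reachable = Connectedness.flag-transitive isPolytope flagAction (mapFlag Φ) Ψ
    v = proj₁ reachable
    η[Φv]≋Ψ : mapFlag (Φ · v) Q.≋ Ψ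
    η[Φv]≋Ψ j = Q.Eq.trans (η-equivariant v {Φ} {mapFlag Φ} (λ _ → Q.Eq.refl) j)
                  (proj₂ reachable j)

  -- For each w, g fixes the translate of the base flag by w, so w g w⁻¹ stabilizes the base flag
  -- and lies in N. Conjugating back puts g into N^w.
  fixes⇒core : ∀ Φ g → Φ · g R.≋ Φ → g ∈ Subgroup.Member (Core group N)
  fixes⇒core Φ g fix w = w ∙ g ∙ w ⁻¹ ,
    proj₂ stabilizer (ActionProperties.conjugate-fixes flagAction (baseFlag W N) w g
      (fixes-quotient Φ g fix (baseFlag W N B.· w))) , sym (begin
    w ⁻¹ ∙ (w ∙ g ∙ w ⁻¹) ∙ w    ≈⟨ ∙-congʳ (∙-congˡ (assoc w g _)) ⟩
    w ⁻¹ ∙ (w ∙ (g ∙ w ⁻¹)) ∙ w  ≈⟨ ∙-congʳ (\\-leftDividesʳ w _) ⟩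
    g ∙ w ⁻¹ ∙ w                 ≈⟨ //-rightDividesˡ w g ⟩
    g                            ∎)

-- Epimorphisms of string C-groups

record Epimorphism {n c ℓ c′ ℓ′} (W : StringCGroup n c ℓ) (W′ : StringCGroup n c′ ℓ′) :
                   Set (c ⊔ ℓ ⊔ c′ ⊔ ℓ′) where
  private
    module W  = StringCGroup W
    module W′ = StringCGroup W′
    module G  = Group W.group
    module G′ = Group W′.group
  field
    φ              : G.Carrier → G′.Carrier
    isHomomorphism : IsGroupHomomorphism G.rawGroup G′.rawGroup φ
    gens-homo      : ∀ k → φ (W.gens k) G′.≈ W′.gens k
    surjective     : StrictlySurjective G′._≈_ φ
  open IsGroupHomomorphism isHomomorphism public

-- The quotient group has the carrier of W with a coarser equality, so the projection is the
-- identity on elements. Viewing it as an abstract epimorphism keeps the two groups apart in the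
-- construction of the covering.
quotientEpimorphism :
  ∀ {n c ℓ p} (W : StringCGroup n c ℓ) → let open StringCGroup W in
  (K : Subgroup group p) (normal : Normal group K)
  (isC : IsStringCGroup (QuotientGroup group K normal) gens) →
  Epimorphism W (stringCGroup (QuotientGroup group K normal) gens isC)
quotientEpimorphism W K normal isC = record
  { φ              = λ x → x
  ; isHomomorphism = record
    { isMonoidHomomorphism = record
      { isMagmaHomomorphism = record
        { isRelHomomorphism = record { cong = ≈⇒∈K }
        ; homo              = λ _ _ → ≈⇒∈K refl
        }
      ; ε-homo = ≈⇒∈K refl
      }
    ; ⁻¹-homo = λ _ → ≈⇒∈K refl
    }
  ; gens-homo      = λ _ → ≈⇒∈K refl
  ; surjective     = λ x → x , ≈⇒∈K refl
  }
  where
  open StringCGroup W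
  open Group group
  ≈⇒∈K : ∀ {x y} → x ≈ y → x ⁻¹ ∙ y ∈ Subgroup.Member K
  ≈⇒∈K {x} x≈y = Subgroup.resp K (trans (sym (inverseˡ x)) (∙-congˡ x≈y)) (Subgroup.ε-closed K)

-- The covering by cosets

module CosetCovering
  {n c ℓ c′ ℓ′} {W : StringCGroup n c ℓ} {W′ : StringCGroup n c′ ℓ′} (π : Epimorphism W W′)
  {a ℓ₁ ℓ₂} {R : RankedPoset n a ℓ₁ ℓ₂} (isPolytope : IsPolytope R)
  (A : FlagAction (StringCGroup.group W) (StringCGroup.gens W) R)
  (fixes⇒kernel : ∀ Φ g → RankedPoset._≋_ R (FlagAction._·_ A Φ g) Φ →
                  Group._≈_ (StringCGroup.group W′) (Epimorphism.φ π g)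
                            (Group.ε (StringCGroup.group W′)))
  (Φ : RankedPoset.Flag R)
  where

  private
    module W  = StringCGroup W
    module W′ = StringCGroup W′
    module R  = RankedPoset R
    module 𝒫′ = RankedPoset (𝒫 W′)
    module G  = Group W.group
  open Group W′.group
  open GroupProperties W′.group
  open SetoidReasoning setoid
  open Epimorphism π
  open FlagAction A
  open ActionProperties A
  open Connectedness isPolytope A
  open PolytopeProperties isPolytope

  ⟨⟩-homo : ∀ {J g} → g ∈ ⟨_⟩ W.group W.gens J → φ g ∈ ⟨_⟩ W′.group W′.gens J
  ⟨⟩-homo (gen j∈)   = resp (sym (gens-homo _)) (gen j∈)
  ⟨⟩-homo unit       = resp (sym ε-homo) unit
  ⟨⟩-homo (mult p q) = resp (sym (homo _ _)) (mult (⟨⟩-homo p) (⟨⟩-homo q))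
  ⟨⟩-homo (inv p)    = resp (sym (⁻¹-homo _)) (inv (⟨⟩-homo p))
  ⟨⟩-homo (resp e p) = resp (⟦⟧-cong e) (⟨⟩-homo p)

  -- The element x⁻¹ y fixes the flag Φ · x, so it lies in the kernel of φ.
  orbit-injective : ∀ x y → Φ · x R.≋ Φ · y → φ x ≈ φ y
  orbit-injective x y eq = begin
    φ x                        ≈⟨ identityʳ _ ⟨
    φ x ∙ ε                    ≈⟨ ∙-congˡ (fixes⇒kernel (Φ · x) _ (\\-fixes Φ x y eq)) ⟨
    φ x ∙ φ (x G.⁻¹ G.∙ y)     ≈⟨ homo _ _ ⟨
    φ (x G.∙ (x G.⁻¹ G.∙ y))   ≈⟨ ⟦⟧-cong (GroupProperties.\\-leftDividesˡ W.group x y) ⟩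
    φ y                        ∎

  reach : ∀ F → ∃ λ w → R.face (Φ · w) (R.rank F) R.≈ F
  reach F =
    let Ψ , F≈ = flag-through F
        w , eq = flag-transitive Φ Ψ
    in w , R.Eq.trans (eq _) (R.Eq.sym F≈)

  toCoset : R.Face → CosetFace W′
  toCoset F = R.rank F , φ (proj₁ (reach F))

  -- This makes the coset independent of the choice made in `reach`: the chosen flag Φ · v and the
  -- flag Φ · w share F, so they differ by some h avoiding the generator of that rank, and φ w = φ v
  -- φ h.
  ∈-toCoset : ∀ {F w} → R.face (Φ · w) (R.rank F) R.≈ F → φ w ∈ coset W′ (toCoset F)
  ∈-toCoset {F} {w} eq =
    let v , eqᵥ = reach F
        h , h∈ , Φvh≋Φw = connect-sharing (R.rank F) (Φ · v) (Φ · w)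
                            (R.Eq.trans eqᵥ (R.Eq.sym eq))
    in resp (begin
         φ h                        ≈⟨ \\-leftDividesʳ (φ v) (φ h) ⟨
         φ v ⁻¹ ∙ (φ v ∙ φ h)       ≈⟨ ∙-congˡ (homo v h) ⟨
         φ v ⁻¹ ∙ φ (v G.∙ h)       ≈⟨ ∙-congˡ (orbit-injective (v G.∙ h) w
                                         λ i → R.Eq.trans (·-∙ Φ v h i) (Φvh≋Φw i)) ⟩
         φ v ⁻¹ ∙ φ w               ∎)
       (⟨⟩-homo h∈)

  ∈-toCoset-face : ∀ {w} Ψ i → Φ · w R.≋ Ψ → φ w ∈ coset W′ (toCoset (R.face Ψ i))
  ∈-toCoset-face Ψ i eq = ∈-toCoset
    (R.Eq.trans (eq _) (R.Eq.reflexive (≡.cong (R.face Ψ) (R.face-rank Ψ i))))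

  -- A flag through both F and G has the form Φ · w, and φ w is then a common element of the two
  -- cosets.
  toCoset-mono : ∀ {F G} → F R.≤ G → toCoset F 𝒫′.≤ toCoset G
  toCoset-mono {F} {G} F≤G =
    let Ψ , F∈∷G∈ = IsPolytope.flags isPolytope (F ∷ G ∷ []) ((inj₁ F≤G ∷ []) ∷ [] ∷ [])
        w , eq    = flag-transitive Φ Ψ
    in R.rank-mono F≤G , φ w ,
       ∈-toCoset (R.Eq.trans (eq _) (R.Eq.sym (∈ᶠ⇒≈ R Ψ (All.head F∈∷G∈)))) ,
       ∈-toCoset (R.Eq.trans (eq _) (R.Eq.sym (∈ᶠ⇒≈ R Ψ (All.head (All.tail F∈∷G∈)))))

  toCoset-face : ∀ i {w w′} → φ w ≈ w′ → toCoset (R.face (Φ · w) i) 𝒫′.≈ (i , w′)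
  toCoset-face i {w} {w′} φw≈w′ = 𝒫′.rank-injective {toCoset (R.face (Φ · w) i)} {i , w′}
    (ℕ.≤-reflexive (≡.cong toℕ (R.face-rank (Φ · w) i)) , φ w ,
     ∈-toCoset-face (Φ · w) i (λ _ → R.Eq.refl) ,
     resp (trans (sym (inverseˡ w′)) (∙-congˡ (sym φw≈w′))) unit)
    (R.face-rank (Φ · w) i)

  generator-∈ : ∀ {J} k x w → x ⁻¹ ∙ φ w ∈ ⟨_⟩ W′.group W′.gens J →
                x ⁻¹ ∙ φ (w G.∙ W.gens k) ∈ ⟨_⟩ W′.group W′.gens J →
                W′.gens k ∈ ⟨_⟩ W′.group W′.gens J
  generator-∈ k x w p q = resp (begin
    (x ⁻¹ ∙ φ w) ⁻¹ ∙ (x ⁻¹ ∙ φ (w G.∙ W.gens k))    ≈⟨ ∙-congˡ (∙-congˡ (homo _ _)) ⟩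
    (x ⁻¹ ∙ φ w) ⁻¹ ∙ (x ⁻¹ ∙ (φ w ∙ φ (W.gens k)))  ≈⟨ ∙-congˡ (∙-congˡ (∙-congˡ (gens-homo k))) ⟩
    (x ⁻¹ ∙ φ w) ⁻¹ ∙ (x ⁻¹ ∙ (φ w ∙ W′.gens k))     ≈⟨ ∙-congˡ (assoc _ _ _) ⟨
    (x ⁻¹ ∙ φ w) ⁻¹ ∙ (x ⁻¹ ∙ φ w ∙ W′.gens k)       ≈⟨ \\-leftDividesʳ _ _ ⟩
    W′.gens k                                        ∎)
    (mult (inv p) q)

  toCoset-separates : ∀ {k Ψ Θ} → R.Adjacent k Ψ Θ →
    ¬ (toCoset (R.face Ψ (proper k)) 𝒫′.≈ toCoset (R.face Θ (proper k)))
  toCoset-separates {k} {Ψ} {Θ} adj (_ , _ , Θ⊆Ψ) =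
    Generation.generator-∉ W′.group W′.isStringCGroup k
      (λ k∈ → k∈ (≡.sym (R.face-rank Ψ (proper k))))
      (generator-∈ k (φ (proj₁ (reach (R.face Ψ (proper k))))) w
        (∈-toCoset-face Ψ (proper k) Φw≋Ψ)
        (Θ⊆Ψ (∈-toCoset-face Θ (proper k) Φws≋Θ)))
    where
    w = proj₁ (flag-transitive Φ Ψ)
    Φw≋Ψ : Φ · w R.≋ Ψ
    Φw≋Ψ = proj₂ (flag-transitive Φ Ψ)
    Φws≋Θ : Φ · (w G.∙ W.gens k) R.≋ Θ
    Φws≋Θ i = R.Eq.trans (·-∙ Φ w (W.gens k) i)
      (R.Eq.trans (·-congʳ {Φ · w} {Ψ} (W.gens k) Φw≋Ψ i)
        (adjacent-unique {k} {Ψ} {Ψ · W.gens k} {Θ} (·-gen Ψ k) adj i))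

  covering : R Covers 𝒫 W′
  covering = record
    { hom                  = cosetHom
    ; rank-preserving      = λ _ → ≡.refl
    ; adjacency-preserving = λ {k} {Ψ} {Θ} adj →
        (λ j j≢k → PosetHomomorphism.cong cosetHom (proj₁ adj j j≢k)) ,
        toCoset-separates {k} {Ψ} {Θ} adj
    ; surjective           = λ (i , w′) → let w , φw≈w′ = surjective w′ in
        R.face (Φ · w) i , toCoset-face i φw≈w′
    }
    where
    cosetHom : PosetHomomorphism R.poset 𝒫′.poset
    cosetHom = mkPosetHomo R.poset 𝒫′.poset toCoset toCoset-mono

theorem3 : ∀ {n c ℓ p a ℓ₁ ℓ₂}
    (W : StringCGroup n c ℓ) → let open StringCGroup W in
    (N : Subgroup group p) →
    IsPolytope (quotient W N) →
    ActsOnQuotient W N →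
    let W/Core = QuotientGroup group (Core group N) (Core-normal group N) in
    (W/Core-isStringC : IsStringCGroup W/Core gens) →
    (R : RankedPoset n a ℓ₁ ℓ₂) →
    IsRegularPolytope R →
    R Covers quotient W N →
    (Φ : RankedPoset.Flag R) (ρ : Fin n → Automorphism R) →
    Distinguished R Φ ρ →
    FlagAction (Aut R) ρ (quotient W N) →
    FlagAction group gens R →
    R Covers 𝒫 (stringCGroup W/Core gens W/Core-isStringC)
theorem3 W N Q-isPolytope acts W/Core-isStringC R R-isRegular η Φ _ _ _ A =
  CosetCovering.covering
    (quotientEpimorphism W (Core group N) (Core-normal group N) W/Core-isStringC)
    {R = R} (IsRegularPolytope.isPolytope R-isRegular) A
    (λ Ψ g fix → Subgroup.resp (Core group N) (Group.sym group (Group.identityʳ group _))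
      (Subgroup.⁻¹-closed (Core group N) (fixes⇒core W Q-isPolytope acts R-isRegular η A Ψ g fix)))
    Φ
  where open StringCGroup W
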